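{- Let $F$ be a field of characteristic $2$ and let $L/F$ be a separable algebraic field extension. Let $\phi,\psi$ be either both totally singular quadratic forms over $F$ or both nonsingular symmetric bilinear forms over $F$. Then $\phi$ and $\psi$ are similar over $F$ if and only if $\phi_L$ and $\psi_L$ are similar over $L$.
   Context: Two forms $\phi,\psi$ over a field $E$ are similar if $\phi\cong c\psi$ for some $c\in E^*$. A totally singular quadratic form is one isometric to $a_1x_1^2+\dots+a_nx_n^2$. -}

module Defs where

open import Algebra.Apartness.Bundles using (HeytingField; HeytingCommutativeRing)
open import Algebra.Bundles using (CommutativeRing)
open import Algebra.Bundles.Raw using (RawRing; RawSemiring)
open import Algebra.Definitions.RawMonoid using (sum)
import Algebra.Definitions.RawSemiring as Divisibility
open import Algebra.Module.Bundles.Raw using (RawLeftModule)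
open import Algebra.Module.Morphism.Structures using (IsLeftModuleIsomorphism)
open import Algebra.Morphism.Structures using (IsRingHomomorphism)
open import Data.Bool.Base using (if_then_else_)
open import Data.Fin.Base using (Fin)
open import Data.Fin.Properties using (_≟_)
open import Data.List.Base using (List; []; _∷_; map; foldr)
open import Data.Nat.Base as ℕ using (ℕ; zero; suc)
open import Data.Product.Base using (∃-syntax; _×_)
open import Data.Vec.Functional using (Vector)
open import Level using (Level; _⊔_)
open import Relation.Nullary.Decidable.Core using (does)

private
  variable
    c ℓ₁ ℓ₂ c′ ℓ₁′ ℓ₂′ : Level

-- A HeytingField is automatically nontrivial, since 0 # 0 is impossible, and
-- x # y says that x - y is invertible.  Under excluded middle it is an
-- ordinary field, with x # y equivalent to ¬ (x ≈ y).

fieldRawRing : HeytingField c ℓ₁ ℓ₂ → RawRing c ℓ₁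
fieldRawRing K = CommutativeRing.rawRing
  (HeytingCommutativeRing.commutativeRing (HeytingField.heytingCommutativeRing K))

HasCharacteristic2 : HeytingField c ℓ₁ ℓ₂ → Set ℓ₁
HasCharacteristic2 K = 1# + 1# ≈ 0#
  where open HeytingField K

module Polynomials (K : HeytingField c ℓ₁ ℓ₂) where
  open HeytingField K
  open Divisibility (RawRing.rawSemiring (fieldRawRing K)) using () renaming (_×_ to _·_)

  -- Coefficients in order of increasing degree; trailing zeros are allowed,
  -- and equality _≈ₚ_ ignores them.
  Poly : Set c
  Poly = List Carrier

  coeff : Poly → ℕ → Carrier
  coeff []      _       = 0#
  coeff (a ∷ _) zero    = a
  coeff (_ ∷ p) (suc k) = coeff p k

  infix 4 _≈ₚ_
  _≈ₚ_ : Poly → Poly → Set ℓ₁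
  p ≈ₚ q = ∀ k → coeff p k ≈ coeff q k

  infixl 6 _+ₚ_
  _+ₚ_ : Poly → Poly → Poly
  []      +ₚ q       = q
  (a ∷ p) +ₚ []      = a ∷ p
  (a ∷ p) +ₚ (b ∷ q) = (a + b) ∷ (p +ₚ q)

  infixl 7 _*ₚ_
  _*ₚ_ : Poly → Poly → Poly
  []      *ₚ q = []
  (a ∷ p) *ₚ q = map (a *_) q +ₚ (0# ∷ (p *ₚ q))

  derivative : Poly → Poly
  derivative []      = []
  derivative (_ ∷ p) = go 1 p
    where
    go : ℕ → Poly → Poly
    go k []      = []
    go k (a ∷ q) = (k · a) ∷ go (suc k) q

  polyRawSemiring : RawSemiring c ℓ₁
  polyRawSemiring = record
    { Carrier = Poly
    ; _≈_     = _≈ₚ_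
    ; _+_     = _+ₚ_
    ; _*_     = _*ₚ_
    ; 0#      = []
    ; 1#      = 1# ∷ []
    }

  open Divisibility polyRawSemiring public using (_∣_; Coprime)

  Monic : Poly → Set ℓ₁
  Monic p = ∃[ d ] coeff p d ≈ 1# × (∀ k → d ℕ.< k → coeff p k ≈ 0#)

  SeparablePoly : Poly → Set (c ⊔ ℓ₁)
  SeparablePoly p = Coprime p (derivative p)

-- Homomorphisms of fields are injective, so L is an extension of F via ι.
record FieldExtension (F : HeytingField c ℓ₁ ℓ₂) (L : HeytingField c′ ℓ₁′ ℓ₂′)
       : Set (c ⊔ ℓ₁ ⊔ c′ ⊔ ℓ₁′) where
  field
    ι                  : HeytingField.Carrier F → HeytingField.Carrier L
    isRingHomomorphism : IsRingHomomorphism (fieldRawRing F) (fieldRawRing L) ι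

module _ {F : HeytingField c ℓ₁ ℓ₂} {L : HeytingField c′ ℓ₁′ ℓ₂′}
         (E : FieldExtension F L) where
  open FieldExtension E
  open HeytingField L
  open Polynomials F using (Poly; Monic; SeparablePoly; _∣_)

  evalAt : Carrier → Poly → Carrier
  evalAt α = foldr (λ a r → ι a + α * r) 0#

  record IsMinimalPolynomial (α : Carrier) (p : Poly) : Set (c ⊔ ℓ₁ ⊔ ℓ₁′) where
    field
      monic   : Monic p
      root    : evalAt α p ≈ 0#
      minimal : ∀ g → evalAt α g ≈ 0# → p ∣ g

  IsSeparableAlgebraic : Set (c ⊔ ℓ₁ ⊔ c′ ⊔ ℓ₁′)
  IsSeparableAlgebraic = ∀ α → ∃[ p ] IsMinimalPolynomial α p × SeparablePoly p

module _ (K : HeytingField c ℓ₁ ℓ₂) where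
  open HeytingField K

  coordinateSpace : ℕ → RawLeftModule Carrier c ℓ₁
  coordinateSpace n = record
    { Carrierᴹ = Vector Carrier n
    ; _≈ᴹ_     = λ x y → ∀ i → x i ≈ y i
    ; _+ᴹ_     = λ x y i → x i + y i
    ; _*ₗ_     = λ a x i → a * x i
    ; 0ᴹ       = λ _ → 0#
    ; -ᴹ_      = λ x i → - x i
    }

  -- The homogeneous quadratic polynomial ∑ᵢ ∑ⱼ aᵢⱼ xᵢ xⱼ.  The coefficient of
  -- xᵢ xⱼ with i ≠ j is aᵢⱼ + aⱼᵢ, so different matrices may give the same form.
  record QuadraticForm (n : ℕ) : Set c where
    constructor quadraticForm
    field
      coefficient : Fin n → Fin n → Carrier

  record BilinearForm (n : ℕ) : Set c where
    constructor bilinearForm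
    field
      gram : Fin n → Fin n → Carrier

module _ {K : HeytingField c ℓ₁ ℓ₂} where
  open HeytingField K

  private
    ∑ : ∀ {n} → Vector Carrier n → Carrier
    ∑ = sum (RawRing.+-rawMonoid (fieldRawRing K))

    LinearIsomorphism : ∀ {m n} → (Vector Carrier m → Vector Carrier n) → Set (c ⊔ ℓ₁)
    LinearIsomorphism {m} {n} =
      IsLeftModuleIsomorphism (coordinateSpace K m) (coordinateSpace K n)

  module Quadratic where
    ⟦_⟧ : ∀ {n} → QuadraticForm K n → Vector Carrier n → Carrier
    ⟦ quadraticForm a ⟧ x = ∑ λ i → ∑ λ j → a i j * (x i * x j)

    scale : ∀ {n} → Carrier → QuadraticForm K n → QuadraticForm K n
    scale e (quadraticForm a) = quadraticForm λ i j → e * a i j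

    diagonal : ∀ {n} → Vector Carrier n → QuadraticForm K n
    diagonal a = quadraticForm λ i j → if does (i ≟ j) then a i else 0#

    infix 4 _≅_
    _≅_ : ∀ {m n} → QuadraticForm K m → QuadraticForm K n → Set (c ⊔ ℓ₁)
    φ ≅ ψ = ∃[ T ] LinearIsomorphism T × (∀ x → ⟦ ψ ⟧ (T x) ≈ ⟦ φ ⟧ x)

    Similar : ∀ {m n} → QuadraticForm K m → QuadraticForm K n → Set (c ⊔ ℓ₁ ⊔ ℓ₂)
    Similar φ ψ = ∃[ e ] e # 0# × φ ≅ scale e ψ

    TotallySingular : ∀ {n} → QuadraticForm K n → Set (c ⊔ ℓ₁)
    TotallySingular {n} φ = ∃[ a ] φ ≅ diagonal {n} a

  module Bilinear where
    ⟦_⟧ : ∀ {n} → BilinearForm K n → Vector Carrier n → Vector Carrier n → Carrier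
    ⟦ bilinearForm b ⟧ x y = ∑ λ i → ∑ λ j → b i j * (x i * y j)

    scale : ∀ {n} → Carrier → BilinearForm K n → BilinearForm K n
    scale e (bilinearForm b) = bilinearForm λ i j → e * b i j

    infix 4 _≅_
    _≅_ : ∀ {m n} → BilinearForm K m → BilinearForm K n → Set (c ⊔ ℓ₁)
    φ ≅ ψ = ∃[ T ] LinearIsomorphism T × (∀ x y → ⟦ ψ ⟧ (T x) (T y) ≈ ⟦ φ ⟧ x y)

    Similar : ∀ {m n} → BilinearForm K m → BilinearForm K n → Set (c ⊔ ℓ₁ ⊔ ℓ₂)
    Similar φ ψ = ∃[ e ] e # 0# × φ ≅ scale e ψ

    Symmetric : ∀ {n} → BilinearForm K n → Set (c ⊔ ℓ₁)
    Symmetric φ = ∀ x y → ⟦ φ ⟧ x y ≈ ⟦ φ ⟧ y x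

    Nonsingular : ∀ {n} → BilinearForm K n → Set (c ⊔ ℓ₁)
    Nonsingular φ = ∀ x → (∀ y → ⟦ φ ⟧ x y ≈ 0#) → ∀ i → x i ≈ 0#

module _ {F : HeytingField c ℓ₁ ℓ₂} {L : HeytingField c′ ℓ₁′ ℓ₂′}
         (E : FieldExtension F L) where
  open FieldExtension E

  extendQ : ∀ {n} → QuadraticForm F n → QuadraticForm L n
  extendQ (quadraticForm a) = quadraticForm λ i j → ι (a i j)

  extendB : ∀ {n} → BilinearForm F n → BilinearForm L n
  extendB (bilinearForm b) = bilinearForm λ i j → ι (b i j)

{-# OPTIONS --safe #-}
module Submission where

-- A family w of elements of L independent over F has independent squares as soon as each wᵢ is an
-- F-combination of the squares; separability provides such families containing any given elements
-- of L, because α lies in F[α²].  Put the entries of a similarity X over L (suitably scaled) and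
-- its inverse Y, together with the factor e, in the span of such a w.  The conditions
-- ψ(Xx) = e φ(x) and φ(Yy) = e ψ(y) on the quadratic forms are linear in e and the squares of the
-- entries, so they persist when X and Y are replaced by their k-th coordinates with respect to w
-- and e by its k-th coordinate γ with respect to w², and so does, in the bilinear case, the
-- F-linear condition that X and Y are adjoint.  Choose k with γ ≠ 0.
--
-- It remains to turn this weak similarity over F into a similarity.  In the totally singular case
-- X is changed by maps of rank one until it is surjective.  In the bilinear case a pair T, U of
-- adjoint maps preserving the quadratic forms is modified until μ = 1 + UT vanishes: as long as it
-- does not, either μ² ≠ μ and a rank one correction enlarges the kernel of μ, or the images of μ
-- and of 1 + TU contain hyperbolic planes, which are then matched with each other.

open import Defs
open import Algebra.Apartness.Bundles using (HeytingField; HeytingCommutativeRing)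
open import Algebra.Bundles using (CommutativeRing)
open import Algebra.Bundles.Raw using (RawRing)
import Algebra.Definitions.RawMagma as RawMagma
open import Algebra.Module.Morphism.Structures using (IsLeftModuleIsomorphism)
open import Algebra.Morphism.Structures using (IsRingHomomorphism)
import Algebra.Properties.Semiring.Sum as SemiringSum
import Algebra.Solver.Ring as RingSolver
open import Algebra.Solver.Ring.AlmostCommutativeRing
  using (fromCommutativeSemiring; _-Raw-AlmostCommutative⟶_; AlmostCommutativeRing; Induced-equivalence)
open import Axiom.ExcludedMiddle using (ExcludedMiddle)
open import Data.Bool.Base using (Bool; true; false; _xor_; _∧_; if_then_else_)
import Data.Bool.Properties as Bool
open import Data.Fin.Base using (Fin; zero; suc; punchIn; punchOut; toℕ; fromℕ<)
import Data.Fin.Properties as Fin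
open import Data.List.Base using ([]; _∷_; map)
open import Data.Maybe.Base using (just; nothing)
open import Data.Nat.Base as ℕ using (ℕ; zero; suc; _≤_; _<_; z≤n; s≤s)
import Data.Nat.Properties as ℕ
open import Data.Product.Base using (_×_; _,_; proj₁; proj₂; ∃; ∃-syntax)
open import Data.Sum.Base as Sum using (_⊎_; inj₁; inj₂)
open import Data.Vec.Functional using (Vector) renaming (_∷_ to _∷ᵥ_)
open import Function.Base using (id; _∘_)
open import Function.Bundles using (_⇔_; mk⇔)
open import Level using (_⊔_; 0ℓ)
open import Relation.Binary.Definitions using (WeaklyDecidable)
open import Relation.Binary.PropositionalEquality.Core as ≡ using (_≡_)
import Relation.Binary.Reasoning.Setoid as SetoidReasoning
open import Relation.Nullary using (¬_; yes; no; contradiction)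
open import Relation.Nullary.Decidable using (does; dec-false)

𝔽₂ : RawRing 0ℓ 0ℓ
𝔽₂ = record { _≈_ = _≡_ ; _+_ = _xor_ ; _*_ = _∧_ ; -_ = id ; 0# = false ; 1# = true }

-- Takes the place of an induction on rank: if a family can be lengthened as long as some defect
-- remains, there is no defect at the `k` found here. The search climbs from 0 with `d` as fuel.
maximal : (∀ {ℓ} → ExcludedMiddle ℓ) → ∀ {p} (P : ℕ → Set p) {n} →
          (∀ {k} → P k → k ≤ n) → P 0 → ∃[ k ] P k × ¬ P (suc k)
maximal em P {n} bound p₀ = search n 0 (ℕ.≤-reflexive (≡.sym (ℕ.+-identityʳ n))) p₀
  where
  search : ∀ d k → n ≤ d ℕ.+ k → P k → ∃[ k ] P k × ¬ P (suc k)
  search d k n≤d+k pₖ with em {P = P (suc k)}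
  ... | no  ¬p = k , pₖ , ¬p
  search zero    k n≤k   pₖ | yes p = contradiction (ℕ.≤-trans (bound p) n≤k) ℕ.1+n≰n
  search (suc d) k n≤d+k pₖ | yes p =
    search d (suc k) (ℕ.≤-trans n≤d+k (ℕ.≤-reflexive (≡.sym (ℕ.+-suc d k)))) p

-- Linear algebra over a field of characteristic 2.

module LinearAlgebra (em : ∀ {ℓ} → ExcludedMiddle ℓ) {c ℓ₁ ℓ₂} (K : HeytingField c ℓ₁ ℓ₂)
                     (char2 : HasCharacteristic2 K) where

  commutativeRing : CommutativeRing c ℓ₁
  commutativeRing = HeytingCommutativeRing.commutativeRing (HeytingField.heytingCommutativeRing K)

  open HeytingField K public using (_#_; #-irrefl)
  open CommutativeRing commutativeRing public hiding (zero)
  open SemiringSum semiring public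
    using (sum; ∑-distrib-+; ∑-comm; *-distribˡ-sum; *-distribʳ-sum)
    renaming (sum-cong-≋ to sum-cong)
  open SetoidReasoning setoid public

  x+x≈0 : ∀ x → x + x ≈ 0#
  x+x≈0 x = begin
    x + x           ≈⟨ +-cong (*-identityˡ x) (*-identityˡ x) ⟨
    1# * x + 1# * x ≈⟨ distribʳ x 1# 1# ⟨
    (1# + 1#) * x   ≈⟨ *-congʳ char2 ⟩
    0# * x          ≈⟨ zeroˡ x ⟩
    0#              ∎

  -x≈x : ∀ x → - x ≈ x
  -x≈x x = begin
    - x           ≈⟨ +-identityʳ (- x) ⟨
    - x + 0#      ≈⟨ +-congˡ (x+x≈0 x) ⟨
    - x + (x + x) ≈⟨ +-assoc (- x) x x ⟨
    - x + x + x   ≈⟨ +-congʳ (-‿inverseˡ x) ⟩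
    0# + x        ≈⟨ +-identityˡ x ⟩
    x             ∎

  private
    almostRing : AlmostCommutativeRing c ℓ₁
    almostRing = fromCommutativeSemiring commutativeSemiring

    fromBool : Bool → Carrier
    fromBool b = if b then 1# else 0#

    morphism : 𝔽₂ -Raw-AlmostCommutative⟶ almostRing
    morphism = record
      { ⟦_⟧    = fromBool
      ; +-homo = λ { true  true  → sym char2 ; true  false → sym (+-identityʳ 1#)
                   ; false b     → sym (+-identityˡ _) }
      ; *-homo = λ { true  b → sym (*-identityˡ _) ; false b → sym (zeroˡ _) }
      ; -‿homo = λ _ → refl
      ; 0-homo = refl
      ; 1-homo = refl
      }

    _≟?_ : WeaklyDecidable (Induced-equivalence morphism)
    a ≟? b with a Bool.≟ b
    ... | yes a≡b = just (reflexive (≡.cong fromBool a≡b))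
    ... | no  _   = nothing

  -- Coefficients in 𝔽₂ let the solver use 1 + 1 = 0.
  open RingSolver 𝔽₂ almostRing morphism _≟?_ public using (solve; _:+_; _:*_; _:=_; con)

  x+y≈0⇒x≈y : ∀ {x y} → x + y ≈ 0# → x ≈ y
  x+y≈0⇒x≈y {x} {y} x+y≈0 = begin
    x         ≈⟨ solve 2 (λ x y → x := x :+ y :+ y) refl x y ⟩
    x + y + y ≈⟨ +-congʳ x+y≈0 ⟩
    0# + y    ≈⟨ +-identityˡ y ⟩
    y         ∎

  ≉⇒# : ∀ {x y} → ¬ x ≈ y → x # y
  ≉⇒# {x} {y} x≉y with em {P = x # y}
  ... | yes x#y = x#y
  ... | no ¬x#y = contradiction (proj₁ (HeytingField.tight K x y) ¬x#y) x≉y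

  #⇒≉ : ∀ {x y} → x # y → ¬ x ≈ y
  #⇒≉ x#y x≈y = #-irrefl x≈y x#y

  1≉0 : ¬ 1# ≈ 0#
  1≉0 1≈0 = #-irrefl refl (HeytingField.invertible⇒# K {0#} {0#}
    (0# , trans (zeroˡ _) (sym 1≈0) , trans (zeroʳ _) (sym 1≈0)))

  inverse : ∀ {x} → ¬ x ≈ 0# → ∃[ y ] y * x ≈ 1#
  inverse {x} x≉0 with HeytingField.#⇒invertible K (≉⇒# x≉0)
  ... | y , y*[x-0]≈1 , _ = y , (begin
    y * x         ≈⟨ solve 2 (λ y x → y :* x := y :* (x :+ con false)) refl y x ⟩
    y * (x + 0#)  ≈⟨ *-congˡ (+-congˡ (-x≈x 0#)) ⟨
    y * (x - 0#)  ≈⟨ y*[x-0]≈1 ⟩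
    1#            ∎)

  Vec : ℕ → Set c
  Vec = Vector Carrier

  infix 4 _≋_
  _≋_ : ∀ {n} → Vec n → Vec n → Set ℓ₁
  x ≋ y = ∀ i → x i ≈ y i

  0ᵥ : ∀ {n} → Vec n
  0ᵥ _ = 0#

  infixl 6 _+ᵥ_
  _+ᵥ_ : ∀ {n} → Vec n → Vec n → Vec n
  (x +ᵥ y) i = x i + y i

  infixr 7 _*ᵥ_
  _*ᵥ_ : ∀ {n} → Carrier → Vec n → Vec n
  (a *ᵥ x) i = a * x i

  ≋-refl : ∀ {n} {x : Vec n} → x ≋ x
  ≋-refl _ = refl

  ≋-sym : ∀ {n} {x y : Vec n} → x ≋ y → y ≋ x
  ≋-sym x≋y i = sym (x≋y i)

  ≋-trans : ∀ {n} {x y z : Vec n} → x ≋ y → y ≋ z → x ≋ z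
  ≋-trans x≋y y≋z i = trans (x≋y i) (y≋z i)

  ≉⇒∃≉0 : ∀ {n} {x : Vec n} → ¬ x ≋ 0ᵥ → ∃[ i ] ¬ x i ≈ 0#
  ≉⇒∃≉0 {x = x} x≉0 with em {P = ∃[ i ] ¬ x i ≈ 0#}
  ... | yes p = p
  ... | no ¬p = contradiction x≋0 x≉0
    where
    x≋0 : x ≋ 0ᵥ
    x≋0 i with em {P = x i ≈ 0#}
    ... | yes xᵢ≈0 = xᵢ≈0
    ... | no  xᵢ≉0 = contradiction (i , xᵢ≉0) ¬p

  cancelˡ : ∀ {a x} → ¬ a ≈ 0# → a * x ≈ 0# → x ≈ 0#
  cancelˡ {a} {x} a≉0 ax≈0 with inverse a≉0
  ... | b , ba≈1 = begin
    x           ≈⟨ *-identityˡ x ⟨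
    1# * x      ≈⟨ *-congʳ ba≈1 ⟨
    b * a * x   ≈⟨ *-assoc b a x ⟩
    b * (a * x) ≈⟨ *-congˡ ax≈0 ⟩
    b * 0#      ≈⟨ zeroʳ b ⟩
    0#          ∎

  sum-zero : ∀ {n} (x : Vec n) → x ≋ 0ᵥ → sum x ≈ 0#
  sum-zero {zero}  x x≋0 = refl
  sum-zero {suc n} x x≋0 = trans (+-cong (x≋0 zero) (sum-zero (x ∘ suc) (x≋0 ∘ suc))) (+-identityˡ 0#)

  δ : ∀ {n} → Fin n → Vec n
  δ zero    zero    = 1#
  δ zero    (suc j) = 0#
  δ (suc i) zero    = 0#
  δ (suc i) (suc j) = δ i j

  sum-δ : ∀ {n} (x : Vec n) i → sum (λ j → x j * δ j i) ≈ x i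
  sum-δ x zero = begin
    x zero * 1# + sum (λ j → x (suc j) * 0#) ≈⟨ +-congˡ (sum-zero _ λ j → zeroʳ (x (suc j))) ⟩
    x zero * 1# + 0#                         ≈⟨ solve 1 (λ x → x :* con true :+ con false := x) refl (x zero) ⟩
    x zero                                   ∎
  sum-δ x (suc i) = begin
    x zero * 0# + sum (λ j → x (suc j) * δ j i) ≈⟨ +-cong (zeroʳ _) (sum-δ (x ∘ suc) i) ⟩
    0# + x (suc i)                              ≈⟨ +-identityˡ _ ⟩
    x (suc i)                                   ∎

  δ-sym : ∀ {n} (i j : Fin n) → δ i j ≈ δ j i
  δ-sym zero    zero    = refl
  δ-sym zero    (suc j) = refl
  δ-sym (suc i) zero    = refl
  δ-sym (suc i) (suc j) = δ-sym i j

  -- Linear combinations, linear maps and dependence.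

  comb : ∀ {m n} → Vec m → (Fin m → Vec n) → Vec n
  comb x v i = sum λ j → x j * v j i

  comb-δ : ∀ {n} (x : Vec n) → comb x δ ≋ x
  comb-δ x = sum-δ x

  record IsLinear {m n} (f : Vec m → Vec n) : Set (c ⊔ ℓ₁) where
    field
      cong   : ∀ {x y} → x ≋ y → f x ≋ f y
      +-homo : ∀ x y → f (x +ᵥ y) ≋ f x +ᵥ f y
      *-homo : ∀ a x → f (a *ᵥ x) ≋ a *ᵥ f x

    0-homo : ∀ {x} → x ≋ 0ᵥ → f x ≋ 0ᵥ
    0-homo {x} x≋0 i = begin
      f x i          ≈⟨ cong (λ j → trans (x≋0 j) (sym (zeroˡ _))) i ⟩
      f (0# *ᵥ x) i  ≈⟨ *-homo 0# x i ⟩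
      0# * f x i     ≈⟨ zeroˡ _ ⟩
      0#             ∎

    comb-homo : ∀ {k} (x : Vec k) (v : Fin k → Vec m) → f (comb x v) ≋ comb x (f ∘ v)
    comb-homo {zero}  x v = 0-homo λ _ → refl
    comb-homo {suc k} x v i = begin
      f (x zero *ᵥ v zero +ᵥ comb (x ∘ suc) (v ∘ suc)) i       ≈⟨ +-homo _ _ i ⟩
      f (x zero *ᵥ v zero) i + f (comb (x ∘ suc) (v ∘ suc)) i  ≈⟨ +-cong (*-homo _ _ i) (comb-homo (x ∘ suc) (v ∘ suc) i) ⟩
      x zero * f (v zero) i + comb (x ∘ suc) (f ∘ v ∘ suc) i   ∎

    expand : ∀ x → f x ≋ comb x (f ∘ δ)
    expand x = ≋-trans (cong (≋-sym (comb-δ x))) (comb-homo x δ)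

  comb-linear : ∀ {m n} (v : Fin m → Vec n) → IsLinear (λ x → comb x v)
  comb-linear v = record
    { cong   = λ x≋y i → sum-cong λ j → *-congʳ (x≋y j)
    ; +-homo = λ x y i → trans (sum-cong λ j → distribʳ (v j i) (x j) (y j)) (∑-distrib-+ (λ j → x j * v j i) λ j → y j * v j i)
    ; *-homo = λ a x i → trans (sum-cong λ j → *-assoc a (x j) (v j i)) (sym (*-distribˡ-sum a λ j → x j * v j i))
    }

  comb-congʳ : ∀ {m n} (x : Vec m) {v w : Fin m → Vec n} → (∀ j → v j ≋ w j) → comb x v ≋ comb x w
  comb-congʳ x v≋w i = sum-cong λ j → *-congˡ (v≋w j i)

  -- Gaussian elimination, by induction on the dimension: a nonzero coordinate `p` of the first
  -- vector serves as pivot and is cleared from the other vectors, which are then restricted to the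
  -- coordinates `punchIn p`.
  dependent : ∀ {m n} → n < m → (v : Fin m → Vec n) →
              ∃[ x ] ¬ x ≋ 0ᵥ × comb x v ≋ 0ᵥ
  dependent {suc m} n<m v with em {P = v zero ≋ 0ᵥ}
  ... | yes v₀≋0 = δ zero , (λ δ≋0 → 1≉0 (δ≋0 zero)) , λ i → begin
    1# * v zero i + sum (λ j → 0# * v (suc j) i) ≈⟨ +-cong (*-congˡ (v₀≋0 i)) (sum-zero _ λ j → zeroˡ (v (suc j) i)) ⟩
    1# * 0# + 0#                                 ≈⟨ solve 0 (con true :* con false :+ con false := con false) refl ⟩
    0#                                           ∎
  dependent {suc m} {zero}  n<m       v | no v₀≉0 = contradiction (λ ()) v₀≉0
  dependent {suc m} {suc n} (s≤s n<m) v | no v₀≉0 with ≉⇒∃≉0 v₀≉0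
  ... | p , v₀ₚ≉0 with inverse v₀ₚ≉0
  ... | a , av₀ₚ≈1 with dependent n<m (λ j i → v (suc j) (punchIn p i) + v (suc j) p * (a * v zero (punchIn p i)))
  -- The relation `x` among the reduced vectors lifts once the first vector gets the coefficient
  -- `a * s`, the total multiple of it that the elimination added.
  ... | x , x≉0 , x⊥ = (a * s) ∷ᵥ x , (λ x≋0 → x≉0 (x≋0 ∘ suc)) , vanishes
    where
    s = sum λ j → x j * v (suc j) p

    vanishes : comb ((a * s) ∷ᵥ x) v ≋ 0ᵥ
    vanishes i with p Fin.≟ i
    ... | yes ≡.refl = begin
      a * s * v zero p + s   ≈⟨ solve 3 (λ a s v → a :* s :* v :+ s := (a :* v) :* s :+ s) refl a s (v zero p) ⟩
      (a * v zero p) * s + s ≈⟨ +-congʳ (*-congʳ av₀ₚ≈1) ⟩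
      1# * s + s             ≈⟨ solve 1 (λ s → con true :* s :+ s := con false) refl s ⟩
      0#                     ∎
    ... | no p≢i = ≡.subst (λ k → comb ((a * s) ∷ᵥ x) v k ≈ 0#) (Fin.punchIn-punchOut p≢i) (begin
      a * s * w + sum (λ j → x j * v (suc j) q)
        ≈⟨ solve 4 (λ a s w t → a :* s :* w :+ t := t :+ s :* (a :* w)) refl a s w (sum λ j → x j * v (suc j) q) ⟩
      sum (λ j → x j * v (suc j) q) + s * (a * w)
        ≈⟨ +-congˡ (*-distribʳ-sum (a * w) λ j → x j * v (suc j) p) ⟩
      sum (λ j → x j * v (suc j) q) + sum (λ j → x j * v (suc j) p * (a * w))
        ≈⟨ ∑-distrib-+ (λ j → x j * v (suc j) q) (λ j → x j * v (suc j) p * (a * w)) ⟨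
      sum (λ j → x j * v (suc j) q + x j * v (suc j) p * (a * w))
        ≈⟨ sum-cong (λ j → solve 4 (λ x v u b → x :* v :+ x :* u :* b := x :* (v :+ u :* b)) refl (x j) (v (suc j) q) (v (suc j) p) (a * w)) ⟩
      sum (λ j → x j * (v (suc j) q + v (suc j) p * (a * w)))
        ≈⟨ x⊥ (punchOut p≢i) ⟩
      0# ∎)
      where
      q = punchIn p (punchOut p≢i)
      w = v zero q

  Independent : ∀ {m n} → (Fin m → Vec n) → Set (c ⊔ ℓ₁)
  Independent v = ∀ x → comb x v ≋ 0ᵥ → x ≋ 0ᵥ

  independent⇒≤ : ∀ {m n} {v : Fin m → Vec n} → Independent v → m ≤ n
  independent⇒≤ {m} {n} {v} indep with m ℕ.≤? n
  ... | yes m≤n = m≤n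
  ... | no  m≰n with dependent (ℕ.≰⇒> m≰n) v
  ...   | x , x≉0 , vx≋0 = contradiction (indep x vx≋0) x≉0

  independent-∷ : ∀ {m n} {v : Fin m → Vec n} {y : Vec n} → Independent v →
                  (∀ x → ¬ comb x v ≋ y) → Independent (y ∷ᵥ v)
  independent-∷ {v = v} {y} indep y∉span x yv≋0 with em {P = x zero ≈ 0#}
  ... | yes x₀≈0 = λ { zero → x₀≈0 ; (suc j) → indep (x ∘ suc) tail≋0 j }
    where
    tail≋0 : comb (x ∘ suc) v ≋ 0ᵥ
    tail≋0 i = begin
      comb (x ∘ suc) v i                ≈⟨ solve 2 (λ s y → s := con false :* y :+ s) refl _ (y i) ⟩
      0# * y i + comb (x ∘ suc) v i     ≈⟨ +-congʳ (*-congʳ x₀≈0) ⟨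
      x zero * y i + comb (x ∘ suc) v i ≈⟨ yv≋0 i ⟩
      0#                                ∎
  ... | no x₀≉0 with inverse x₀≉0
  ...   | a , ax₀≈1 = contradiction (λ i → begin
    comb (a *ᵥ (x ∘ suc)) v i  ≈⟨ IsLinear.*-homo (comb-linear v) a (x ∘ suc) i ⟩
    a * comb (x ∘ suc) v i     ≈⟨ *-congˡ (x+y≈0⇒x≈y (yv≋0 i)) ⟨
    a * (x zero * y i)         ≈⟨ *-assoc a (x zero) (y i) ⟨
    a * x zero * y i           ≈⟨ *-congʳ ax₀≈1 ⟩
    1# * y i                   ≈⟨ *-identityˡ (y i) ⟩
    y i                        ∎) (y∉span _)

  module _ {m n} {f : Vec m → Vec n} (f-linear : IsLinear f) where
    open IsLinear f-linear

    Injective Surjective : Set (c ⊔ ℓ₁)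
    Injective  = ∀ {x} → f x ≋ 0ᵥ → x ≋ 0ᵥ
    Surjective = ∀ y → ∃[ x ] f x ≋ y

    injective⇒independent : Injective → Independent (f ∘ δ)
    injective⇒independent inj x fx≋0 = inj (≋-trans (expand x) fx≋0)

    injective⇒≤ : Injective → m ≤ n
    injective⇒≤ inj = independent⇒≤ (injective⇒independent inj)

  module _ {n} {f : Vec n → Vec n} (f-linear : IsLinear f) where
    open IsLinear f-linear

    -- A vector outside the image could be adjoined to the `n` independent images of the basis
    -- vectors, giving `suc n` independent vectors in dimension `n`.
    injective⇒surjective : Injective f-linear → Surjective f-linear
    injective⇒surjective inj y with em {P = ∃[ x ] comb x (f ∘ δ) ≋ y}
    ... | yes (x , fx≋y) = x , ≋-trans (expand x) fx≋y
    ... | no  ¬surj = contradiction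
      (independent⇒≤ {v = y ∷ᵥ (f ∘ δ)} (independent-∷ (injective⇒independent f-linear inj) λ x fx≋y → ¬surj (x , fx≋y))) ℕ.1+n≰n

  module _ {n} {f : Vec n → Vec n} (f-linear : IsLinear f) where
    open IsLinear f-linear

    -- As `f ∘ g` is the identity, `g` is injective, hence surjective, and `x` can be written as
    -- `g y`.
    rightInverse⇒leftInverse : ∀ {g} → IsLinear g → (∀ x → f (g x) ≋ x) → ∀ x → g (f x) ≋ x
    rightInverse⇒leftInverse {g} g-linear fg≋id x
      with injective⇒surjective g-linear (λ {x} gx≋0 → ≋-trans (≋-sym (fg≋id x)) (0-homo gx≋0)) x
    ... | y , gy≋x = ≋-trans (IsLinear.cong g-linear (≋-trans (cong (≋-sym gy≋x)) (fg≋id y))) gy≋x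

    surjective⇒inverse : Surjective f-linear → ∃[ g ] IsLinear g × (∀ y → f (g y) ≋ y) × (∀ x → g (f x) ≋ x)
    surjective⇒inverse surj = g , g-linear , fg≋id , rightInverse⇒leftInverse g-linear fg≋id
      where
      g : Vec n → Vec n
      g y = comb y λ j → proj₁ (surj (δ j))

      g-linear : IsLinear g
      g-linear = comb-linear _

      fg≋id : ∀ y → f (g y) ≋ y
      fg≋id y = ≋-trans (comb-homo y _) (≋-trans (comb-congʳ y λ j → proj₂ (surj (δ j))) (comb-δ y))

-- Symmetric bilinear forms and weak isometries.

module WeakIsometries (em : ∀ {ℓ} → ExcludedMiddle ℓ) {c ℓ₁ ℓ₂} (K : HeytingField c ℓ₁ ℓ₂)
                      (char2 : HasCharacteristic2 K) where
  open LinearAlgebra em K char2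

  ∘-linear : ∀ {l m n} {f : Vec m → Vec n} {g : Vec l → Vec m} →
             IsLinear f → IsLinear g → IsLinear (f ∘ g)
  ∘-linear f-linear g-linear = record
    { cong   = F.cong ∘ G.cong
    ; +-homo = λ x y → ≋-trans (F.cong (G.+-homo x y)) (F.+-homo _ _)
    ; *-homo = λ a x → ≋-trans (F.cong (G.*-homo a x)) (F.*-homo _ _)
    }
    where
    module F = IsLinear f-linear
    module G = IsLinear g-linear

  id-linear : ∀ {n} → IsLinear {n} id
  id-linear = record { cong = id ; +-homo = λ _ _ → ≋-refl ; *-homo = λ _ _ → ≋-refl }

  +-linear : ∀ {m n} {f g : Vec m → Vec n} → IsLinear f → IsLinear g → IsLinear (λ x → f x +ᵥ g x)
  +-linear f-linear g-linear = record
    { cong   = λ x≋y i → +-cong (F.cong x≋y i) (G.cong x≋y i)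
    ; +-homo = λ x y i → trans (+-cong (F.+-homo x y i) (G.+-homo x y i))
        (solve 4 (λ p q r s → p :+ q :+ (r :+ s) := p :+ r :+ (q :+ s)) refl _ _ _ _)
    ; *-homo = λ a x i → trans (+-cong (F.*-homo a x i) (G.*-homo a x i)) (sym (distribˡ a _ _))
    }
    where
    module F = IsLinear f-linear
    module G = IsLinear g-linear

  record IsFunctional {n} (ℓ : Vec n → Carrier) : Set (c ⊔ ℓ₁) where
    field
      cong   : ∀ {x y} → x ≋ y → ℓ x ≈ ℓ y
      +-homo : ∀ x y → ℓ (x +ᵥ y) ≈ ℓ x + ℓ y
      *-homo : ∀ a x → ℓ (a *ᵥ x) ≈ a * ℓ x

  functional-linear : ∀ {m n} {ℓ : Vec m → Carrier} → IsFunctional ℓ → (y : Vec n) → IsLinear (λ x → ℓ x *ᵥ y)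
  functional-linear ℓ-linear y = record
    { cong   = λ x≋y i → *-congʳ (cong x≋y)
    ; +-homo = λ x y i → trans (*-congʳ (+-homo x y)) (distribʳ _ _ _)
    ; *-homo = λ a x i → trans (*-congʳ (*-homo a x)) (*-assoc a _ _)
    }
    where open IsFunctional ℓ-linear

  record IsSymmetricBilinear {n} (b : Vec n → Vec n → Carrier) : Set (c ⊔ ℓ₁) where
    field
      cong   : ∀ {x x′ y y′} → x ≋ x′ → y ≋ y′ → b x y ≈ b x′ y′
      symm   : ∀ x y → b x y ≈ b y x
      +-homo : ∀ x y z → b (x +ᵥ y) z ≈ b x z + b y z
      *-homo : ∀ a x z → b (a *ᵥ x) z ≈ a * b x z

    congˡ : ∀ {x y y′} → y ≋ y′ → b x y ≈ b x y′
    congˡ = cong ≋-refl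

    congʳ : ∀ {x x′ y} → x ≋ x′ → b x y ≈ b x′ y
    congʳ x≋x′ = cong x≋x′ ≋-refl

    +-homoʳ : ∀ z x y → b z (x +ᵥ y) ≈ b z x + b z y
    +-homoʳ z x y = trans (symm z _) (trans (+-homo x y z) (+-cong (symm x z) (symm y z)))

    *-homoʳ : ∀ a z x → b z (a *ᵥ x) ≈ a * b z x
    *-homoʳ a z x = trans (symm z _) (trans (*-homo a x z) (*-congˡ (symm x z)))

    functionalʳ : ∀ z → IsFunctional (b z)
    functionalʳ z = record { cong = congˡ ; +-homo = +-homoʳ z ; *-homo = λ a x → *-homoʳ a z x }

    0-homo : ∀ {x} → x ≋ 0ᵥ → ∀ y → b x y ≈ 0#
    0-homo x≋0 y = trans (congʳ λ i → trans (x≋0 i) (sym (zeroˡ 0#))) (trans (*-homo 0# 0ᵥ y) (zeroˡ _))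

    -- The two cross terms agree and cancel in characteristic 2, so `x ↦ b x x` is a totally
    -- singular quadratic form.
    +-quad : ∀ x y → b (x +ᵥ y) (x +ᵥ y) ≈ b x x + b y y
    +-quad x y = begin
      b (x +ᵥ y) (x +ᵥ y)             ≈⟨ trans (+-homo x y _) (+-cong (+-homoʳ x x y) (+-homoʳ y x y)) ⟩
      b x x + b x y + (b y x + b y y) ≈⟨ +-congˡ (+-congʳ (symm y x)) ⟩
      b x x + b x y + (b x y + b y y) ≈⟨ solve 3 (λ p q r → p :+ q :+ (q :+ r) := p :+ r) refl _ _ _ ⟩
      b x x + b y y                   ∎

    *-quad : ∀ a x → b (a *ᵥ x) (a *ᵥ x) ≈ a * a * b x x
    *-quad a x = trans (*-homo a x _) (trans (*-congˡ (*-homoʳ a x x)) (sym (*-assoc a a _)))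

    -- Each correction of a weak isometry below adds multiples of isotropic vectors; this keeps the
    -- quadratic conditions intact.
    +*-quad : ∀ x a {y} → b y y ≈ 0# → b (x +ᵥ a *ᵥ y) (x +ᵥ a *ᵥ y) ≈ b x x
    +*-quad x a {y} byy≈0 = begin
      b (x +ᵥ a *ᵥ y) (x +ᵥ a *ᵥ y)   ≈⟨ +-quad x (a *ᵥ y) ⟩
      b x x + b (a *ᵥ y) (a *ᵥ y)     ≈⟨ +-congˡ (trans (*-quad a y) (*-congˡ byy≈0)) ⟩
      b x x + a * a * 0#              ≈⟨ solve 2 (λ p a → p :+ a :* a :* con false := p) refl _ a ⟩
      b x x                           ∎

    +*-homo : ∀ x a y z → b (x +ᵥ a *ᵥ y) z ≈ b x z + a * b y z
    +*-homo x a y z = trans (+-homo x _ z) (+-congˡ (*-homo a y z))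

    +*-homoʳ : ∀ z x a y → b z (x +ᵥ a *ᵥ y) ≈ b z x + a * b z y
    +*-homoʳ z x a y = trans (+-homoʳ z x _) (+-congˡ (*-homoʳ a z y))

  NonDegenerate : ∀ {n} → (Vec n → Vec n → Carrier) → Set (c ⊔ ℓ₁)
  NonDegenerate b = ∀ x → (∀ y → b x y ≈ 0#) → x ≋ 0ᵥ

  dualVector : ∀ {n} {b : Vec n → Vec n → Carrier} → IsSymmetricBilinear b → NonDegenerate b →
               ∀ {x} → ¬ x ≋ 0ᵥ → ∃[ y ] b x y ≈ 1#
  dualVector {b = b} b-bilinear nondeg {x} x≉0 with em {P = ∃[ y ] ¬ b x y ≈ 0#}
  ... | yes (y , bxy≉0) = let a , abxy≈1 = inverse bxy≉0 in
    a *ᵥ y , trans (IsSymmetricBilinear.*-homoʳ b-bilinear a x y) abxy≈1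
  ... | no ¬p = contradiction (nondeg x x⊥) x≉0
    where
    x⊥ : ∀ y → b x y ≈ 0#
    x⊥ y with em {P = b x y ≈ 0#}
    ... | yes p = p
    ... | no ¬q = contradiction (y , ¬q) ¬p

  -- These conditions survive the passage to coordinates, under which invertibility is lost. Once
  -- `U ∘ T` is the identity, `T` is an isometry of bilinear forms:
  -- `b (T x) (T y) = a x (U (T y)) = a x y`.
  record IsWeakIsometry {n} (a b : Vec n → Vec n → Carrier) (T U : Vec n → Vec n) : Set (c ⊔ ℓ₁) where
    field
      T-linear : IsLinear T
      U-linear : IsLinear U
      adjoint  : ∀ x y → b (T x) y ≈ a x (U y)
      T-quad   : ∀ x → b (T x) (T x) ≈ a x x
      U-quad   : ∀ y → a (U y) (U y) ≈ b y y

  -- The defect `μ = 1 + U ∘ T` and how to enlarge its kernel.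

  module Defect {n} {a b : Vec n → Vec n → Carrier} (A : IsSymmetricBilinear a) (B : IsSymmetricBilinear b)
                {T U : Vec n → Vec n} (w : IsWeakIsometry a b T U) where
    open IsWeakIsometry w
    private
      module A = IsSymmetricBilinear A
      module B = IsSymmetricBilinear B
      module T = IsLinear T-linear
      module U = IsLinear U-linear

    UT-linear : IsLinear (U ∘ T)
    UT-linear = ∘-linear U-linear T-linear

    μ : Vec n → Vec n
    μ x = x +ᵥ U (T x)

    UT-selfAdjoint : ∀ x y → a (U (T x)) y ≈ a x (U (T y))
    UT-selfAdjoint x y = begin
      a (U (T x)) y ≈⟨ A.symm _ _ ⟩
      a y (U (T x)) ≈⟨ adjoint y (T x) ⟨
      b (T y) (T x) ≈⟨ B.symm _ _ ⟩
      b (T x) (T y) ≈⟨ adjoint x (T y) ⟩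
      a x (U (T y)) ∎

    μ-selfAdjoint : ∀ x y → a (μ x) y ≈ a x (μ y)
    μ-selfAdjoint x y = trans (A.+-homo _ _ _) (trans (+-congˡ (UT-selfAdjoint x y)) (sym (A.+-homoʳ _ _ _)))

    -- Adjointness turns `a x (U (T x))` into `b (T x) (T x)`, which is `a x x`. Together with
    -- `μ-selfAdjoint`, the form `a x (μ y)` is alternating.
    μ-alternating : ∀ x → a x (μ x) ≈ 0#
    μ-alternating x = begin
      a x (μ x)             ≈⟨ A.+-homoʳ x x _ ⟩
      a x x + a x (U (T x)) ≈⟨ +-congˡ (trans (sym (adjoint x (T x))) (T-quad x)) ⟩
      a x x + a x x         ≈⟨ x+x≈0 _ ⟩
      0#                    ∎

    UT-quad : ∀ x → a (U (T x)) (U (T x)) ≈ a x x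
    UT-quad x = trans (U-quad (T x)) (T-quad x)

    -- Makes the vectors `μ x` admissible directions for corrections by `+*-quad`.
    μ-isotropic : ∀ x → a (μ x) (μ x) ≈ 0#
    μ-isotropic x = trans (A.+-quad x _) (trans (+-congˡ (UT-quad x)) (x+x≈0 _))

    fixed⇒μ≋0 : ∀ {x} → U (T x) ≋ x → μ x ≋ 0ᵥ
    fixed⇒μ≋0 UTx≋x i = trans (+-congˡ (UTx≋x i)) (x+x≈0 _)

    μ≋0⇒fixed : ∀ {x} → μ x ≋ 0ᵥ → U (T x) ≋ x
    μ≋0⇒fixed μx≋0 i = sym (x+y≈0⇒x≈y (μx≋0 i))

    -- The fixed space of `U ∘ T`, which is the kernel of `μ`, grows strictly, with `y` as a new
    -- member.
    Improvement : Set (c ⊔ ℓ₁)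
    Improvement = ∃[ T′ ] ∃[ U′ ] IsWeakIsometry a b T′ U′ ×
      (∀ x → U (T x) ≋ x → U′ (T′ x) ≋ x) × ∃[ y ] U′ (T′ y) ≋ y × ¬ U (T y) ≋ y

    -- With `e = μ z`, a vector `f` such that `a (e + μ e) f = 1` becomes fixed after a rank one
    -- change of `T` and of `U`. Old fixed vectors are orthogonal to the image of `μ`, so the change
    -- does not affect them.
    improve₁ : NonDegenerate a → ∀ z → ¬ μ z +ᵥ μ (μ z) ≋ 0ᵥ → Improvement
    improve₁ nondeg z g≉0 with dualVector A nondeg g≉0
    ... | f , agf≈1 = T′ , U′ , weak , fixed , f , f-fixed , f-notFixed
      where
      e m : Vec n
      e = μ z
      m = μ f

      -- `T` is composed with `S`, and `U` with the `a`-adjoint of `S`, which is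
      -- `y ↦ y + a e y *ᵥ m`. Both `e` and `m` lie in the image of `μ`, hence are isotropic.
      S : Vec n → Vec n
      S x = x +ᵥ a m x *ᵥ e

      T′ U′ : Vec n → Vec n
      T′ x = T (S x)
      U′ y = U y +ᵥ a e (U y) *ᵥ m

      weak : IsWeakIsometry a b T′ U′
      weak = record
        { T-linear = ∘-linear T-linear (+-linear id-linear (functional-linear (A.functionalʳ m) e))
        ; U-linear = ∘-linear (+-linear id-linear (functional-linear (A.functionalʳ e) m)) U-linear
        ; adjoint  = λ x y → begin
            b (T (S x)) y                       ≈⟨ adjoint (S x) y ⟩
            a (S x) (U y)                       ≈⟨ A.+*-homo x _ e (U y) ⟩
            a x (U y) + a m x * a e (U y)       ≈⟨ +-congˡ (trans (*-congʳ (A.symm m x)) (*-comm _ _)) ⟩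
            a x (U y) + a e (U y) * a x m       ≈⟨ A.+*-homoʳ x (U y) _ m ⟨
            a x (U′ y)                          ∎
        ; T-quad   = λ x → trans (T-quad (S x)) (A.+*-quad x _ (μ-isotropic z))
        ; U-quad   = λ y → trans (A.+*-quad (U y) _ (μ-isotropic f)) (U-quad y)
        }

      S-fix : ∀ {x} → a m x ≈ 0# → S x ≋ x
      S-fix amx≈0 i = trans (+-congˡ (trans (*-congʳ amx≈0) (zeroˡ _))) (+-identityʳ _)

      fixed : ∀ x → U (T x) ≋ x → U′ (T′ x) ≋ x
      fixed x UTx≋x = ≋-trans (λ i → +-cong (UT′x≋x i) (trans (*-congʳ aeUT′x≈0) (zeroˡ _))) λ i → +-identityʳ _
        where
        kills : ∀ y → a (μ y) x ≈ 0#
        kills y = trans (μ-selfAdjoint y x) (trans (A.symm y _) (A.0-homo (fixed⇒μ≋0 UTx≋x) y))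

        UT′x≋x : U (T′ x) ≋ x
        UT′x≋x = ≋-trans (U.cong (T.cong (S-fix (kills f)))) UTx≋x

        aeUT′x≈0 : a e (U (T′ x)) ≈ 0#
        aeUT′x≈0 = trans (A.congˡ UT′x≋x) (kills z)

      -- Self-adjointness moves `U ∘ T` over to `e`, and `U (T e) = e + μ e`; the value is then the
      -- one for which `f` was chosen.
      aeUTf≈1 : a e (U (T f)) ≈ 1#
      aeUTf≈1 = begin
        a e (U (T f))       ≈⟨ UT-selfAdjoint e f ⟨
        a (U (T e)) f       ≈⟨ A.congʳ (λ i → solve 2 (λ e u → u := e :+ (e :+ u)) refl (e i) (U (T e) i)) ⟩
        a (e +ᵥ μ e) f      ≈⟨ agf≈1 ⟩
        1#                  ∎

      -- `S` leaves `f` alone because `a f (μ f)` vanishes; adding `m = f + U (T f)` then turns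
      -- `U (T f)` into `f`.
      f-fixed : U′ (T′ f) ≋ f
      f-fixed i = begin
        U′ (T′ f) i                         ≈⟨ +-cong (UT′f i) (*-congʳ (trans (A.congˡ UT′f) aeUTf≈1)) ⟩
        U (T f) i + 1# * (f i + U (T f) i)  ≈⟨ solve 2 (λ u f → u :+ con true :* (f :+ u) := f) refl _ _ ⟩
        f i                                 ∎
        where
        UT′f : U (T′ f) ≋ U (T f)
        UT′f = U.cong (T.cong (S-fix (trans (A.symm m f) (μ-alternating f))))

      f-notFixed : ¬ U (T f) ≋ f
      f-notFixed UTf≋f = 1≉0 (begin
        1#                ≈⟨ aeUTf≈1 ⟨
        a e (U (T f))     ≈⟨ A.congˡ UTf≋f ⟩
        a (μ z) f         ≈⟨ μ-selfAdjoint z f ⟩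
        a z (μ f)         ≈⟨ A.symm z _ ⟩
        a (μ f) z         ≈⟨ A.0-homo (fixed⇒μ≋0 UTf≋f) z ⟩
        0#                ∎)

    -- The hypotheses make `μ` and `ν = 1 + T ∘ U` projections onto the kernels of `T` and `U`. Each
    -- kernel contains a hyperbolic plane, spanned by `e`, `f` and by `e′`, `f′`, and the two planes
    -- are matched.
    improve₂ : NonDegenerate a → NonDegenerate b →
               (∀ x → T (U (T x)) ≋ T x) → (∀ y → U (T (U y)) ≋ U y) →
               ∀ z → ¬ U (T z) ≋ z → Improvement
    improve₂ a-nondeg b-nondeg TUT≋T UTU≋U z z-notFixed with em {P = ∃[ y ] ¬ T (U y) ≋ y}
    -- If `T ∘ U` were the identity, so would be `U ∘ T`, against the choice of `z`.
    ... | no ¬p = contradiction (rightInverse⇒leftInverse T-linear U-linear TU≋id z) z-notFixed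
      where
      TU≋id : ∀ y → T (U y) ≋ y
      TU≋id y with em {P = T (U y) ≋ y}
      ... | yes p = p
      ... | no ¬q = contradiction (y , ¬q) ¬p
    ... | yes (y , y-notFixed)
      with dualVector A a-nondeg (z-notFixed ∘ μ≋0⇒fixed)
         | dualVector B b-nondeg {y +ᵥ T (U y)} (λ p → y-notFixed λ i → sym (x+y≈0⇒x≈y (p i)))
    ... | f₀ , aef₀≈1 | f₀′ , be′f₀′≈1 = T′ , U′ , weak , fixed , e , e-fixed , e-notFixed
      where
      ν : Vec n → Vec n
      ν y = y +ᵥ T (U y)

      Tμ≋0 : ∀ x → T (μ x) ≋ 0ᵥ
      Tμ≋0 x i = trans (T.+-homo x _ i) (trans (+-congˡ (TUT≋T x i)) (x+x≈0 _))

      Uν≋0 : ∀ y → U (ν y) ≋ 0ᵥ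
      Uν≋0 y i = trans (U.+-homo y _ i) (trans (+-congˡ (UTU≋U y i)) (x+x≈0 _))

      ν-isotropic : ∀ y → b (ν y) (ν y) ≈ 0#
      ν-isotropic y = trans (B.+-quad y _) (trans (+-congˡ (trans (T-quad (U y)) (U-quad y))) (x+x≈0 _))

      e f e′ f′ : Vec n
      e  = μ z
      f  = μ f₀
      e′ = ν y
      f′ = ν f₀′

      -- Projecting `f₀` to `μ f₀` makes it isotropic; its product with `e` remains 1 because `T e`
      -- vanishes.
      aef≈1 : a e f ≈ 1#
      aef≈1 = begin
        a e (f₀ +ᵥ U (T f₀))     ≈⟨ A.+-homoʳ e f₀ _ ⟩
        a e f₀ + a e (U (T f₀))  ≈⟨ +-cong aef₀≈1 (sym (adjoint e (T f₀))) ⟩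
        1# + b (T e) (T f₀)      ≈⟨ +-congˡ (B.0-homo (Tμ≋0 z) _) ⟩
        1# + 0#                  ≈⟨ +-identityʳ 1# ⟩
        1#                       ∎

      be′f′≈1 : b e′ f′ ≈ 1#
      be′f′≈1 = begin
        b e′ (f₀′ +ᵥ T (U f₀′))     ≈⟨ B.+-homoʳ e′ f₀′ _ ⟩
        b e′ f₀′ + b e′ (T (U f₀′)) ≈⟨ +-cong be′f₀′≈1 (trans (B.symm _ _) (adjoint (U f₀′) e′)) ⟩
        1# + a (U f₀′) (U e′)       ≈⟨ +-congˡ (trans (A.symm _ _) (A.0-homo (Uν≋0 y) _)) ⟩
        1# + 0#                     ≈⟨ +-identityʳ 1# ⟩
        1#                          ∎

      -- `T′` adds to `T` the map sending `e` to `e′` and `f` to `f′`; `U′` adds to `U` the map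
      -- going back.
      T′ U′ : Vec n → Vec n
      T′ x = T x +ᵥ a f x *ᵥ e′ +ᵥ a e x *ᵥ f′
      U′ y = U y +ᵥ b f′ y *ᵥ e +ᵥ b e′ y *ᵥ f

      weak : IsWeakIsometry a b T′ U′
      weak = record
        { T-linear = +-linear (+-linear T-linear (functional-linear (A.functionalʳ f) e′)) (functional-linear (A.functionalʳ e) f′)
        ; U-linear = +-linear (+-linear U-linear (functional-linear (B.functionalʳ f′) e)) (functional-linear (B.functionalʳ e′) f)
        ; adjoint  = λ x y → begin
            b (T′ x) y                                          ≈⟨ trans (B.+*-homo _ _ f′ y) (+-congʳ (B.+*-homo _ _ e′ y)) ⟩
            b (T x) y + a f x * b e′ y + a e x * b f′ y         ≈⟨ +-cong (+-cong (adjoint x y) (*-congʳ (A.symm f x))) (*-congʳ (A.symm e x)) ⟩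
            a x (U y) + a x f * b e′ y + a x e * b f′ y
              ≈⟨ solve 5 (λ p q r s t → p :+ q :* r :+ s :* t := p :+ t :* s :+ r :* q) refl _ _ _ _ _ ⟩
            a x (U y) + b f′ y * a x e + b e′ y * a x f         ≈⟨ trans (A.+*-homoʳ x _ _ f) (+-congʳ (A.+*-homoʳ x _ _ e)) ⟨
            a x (U′ y)                                          ∎
        ; T-quad   = λ x → trans (B.+*-quad _ _ (ν-isotropic f₀′)) (trans (B.+*-quad _ _ (ν-isotropic y)) (T-quad x))
        ; U-quad   = λ y → trans (A.+*-quad _ _ (μ-isotropic f₀)) (trans (A.+*-quad _ _ (μ-isotropic z)) (U-quad y))
        }
      module T′ = IsLinear (IsWeakIsometry.T-linear weak)
      module U′ = IsLinear (IsWeakIsometry.U-linear weak)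

      fixed : ∀ x → U (T x) ≋ x → U′ (T′ x) ≋ x
      fixed x UTx≋x i = begin
        U′ (T′ x) i                                      ≈⟨ U′.cong T′x≋Tx i ⟩
        U (T x) i + b f′ (T x) * e i + b e′ (T x) * f i  ≈⟨ +-cong (+-cong (UTx≋x i) (*-congʳ (kills′ f₀′))) (*-congʳ (kills′ y)) ⟩
        x i + 0# * e i + 0# * f i                        ≈⟨ solve 3 (λ x e f → x :+ con false :* e :+ con false :* f := x) refl _ _ _ ⟩
        x i                                              ∎
        where
        kills : ∀ w → a (μ w) x ≈ 0#
        kills w = trans (μ-selfAdjoint w x) (trans (A.symm w _) (A.0-homo (fixed⇒μ≋0 UTx≋x) w))

        kills′ : ∀ w → b (ν w) (T x) ≈ 0#
        kills′ w = trans (B.symm _ _) (trans (adjoint x (ν w)) (trans (A.symm _ _) (A.0-homo (Uν≋0 w) x)))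

        T′x≋Tx : T′ x ≋ T x
        T′x≋Tx i = begin
          T x i + a f x * e′ i + a e x * f′ i ≈⟨ +-cong (+-congˡ (*-congʳ (kills f₀))) (*-congʳ (kills z)) ⟩
          T x i + 0# * e′ i + 0# * f′ i       ≈⟨ solve 3 (λ x e f → x :+ con false :* e :+ con false :* f := x) refl _ _ _ ⟩
          T x i                               ∎

      e-fixed : U′ (T′ e) ≋ e
      e-fixed i = begin
        U′ (T′ e) i                                   ≈⟨ U′.cong T′e≋e′ i ⟩
        U e′ i + b f′ e′ * e i + b e′ e′ * f i        ≈⟨ +-cong (+-cong (Uν≋0 y i) (*-congʳ (trans (B.symm f′ e′) be′f′≈1))) (*-congʳ (ν-isotropic y)) ⟩
        0# + 1# * e i + 0# * f i                      ≈⟨ solve 2 (λ e f → con false :+ con true :* e :+ con false :* f := e) refl _ _ ⟩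
        e i                                           ∎
        where
        T′e≋e′ : T′ e ≋ e′
        T′e≋e′ i = begin
          T e i + a f e * e′ i + a e e * f′ i         ≈⟨ +-cong (+-cong (Tμ≋0 z i) (*-congʳ (trans (A.symm f e) aef≈1))) (*-congʳ (μ-isotropic z)) ⟩
          0# + 1# * e′ i + 0# * f′ i                  ≈⟨ solve 2 (λ e f → con false :+ con true :* e :+ con false :* f := e) refl _ _ ⟩
          e′ i                                        ∎

      -- Since `T e` vanishes, `e` could be fixed only by being zero, and then `z` would be fixed.
      e-notFixed : ¬ U (T e) ≋ e
      e-notFixed UTe≋e = z-notFixed (μ≋0⇒fixed (≋-trans (≋-sym UTe≋e) (U.0-homo (Tμ≋0 z))))

  -- From weak isometries to isometries.

  module _ {n} {a b : Vec n → Vec n → Carrier} (A : IsSymmetricBilinear a) (B : IsSymmetricBilinear b)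
           (a-nondeg : NonDegenerate a) (b-nondeg : NonDegenerate b) where

    -- When `improve₁` does not apply, `U ∘ T` is idempotent. Passing to `T ∘ U ∘ T` and `U ∘ T ∘ U`
    -- replaces it by its cube, that is by itself, and yields the two identities that `improve₂`
    -- asks for.
    improve : ∀ {T U} (w : IsWeakIsometry a b T U) → ∀ z → ¬ U (T z) ≋ z → Defect.Improvement A B w
    improve {T} {U} w z z-notFixed with em {P = ∃[ x ] ¬ Defect.μ A B w x +ᵥ Defect.μ A B w (Defect.μ A B w x) ≋ 0ᵥ}
    ... | yes (x , p) = Defect.improve₁ A B w a-nondeg x p
    ... | no ¬p = let T′ , U′ , weak′ , fixed , y , y-fixed , y-notFixed = improved in
      T′ , U′ , weak′ , (λ x UTx≋x → fixed x (≋-trans (UT³≋UT x) UTx≋x)) ,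
      y , y-fixed , λ UTy≋y → y-notFixed (≋-trans (UT³≋UT y) UTy≋y)
      where
      open IsWeakIsometry w
      open Defect A B w using (μ; UT-linear; UT-selfAdjoint; UT-quad)
      module T = IsLinear T-linear
      module UT = IsLinear UT-linear

      UTUT≋UT : ∀ x → U (T (U (T x))) ≋ U (T x)
      UTUT≋UT x with em {P = μ x +ᵥ μ (μ x) ≋ 0ᵥ}
      ... | no ¬q = contradiction (x , ¬q) ¬p
      -- In characteristic 2, `μ x + μ (μ x)` is `U (T x) + U (T (U (T x)))`.
      ... | yes q = λ i → sym (x+y≈0⇒x≈y (trans (trans
        (solve 3 (λ x u v → u :+ v := x :+ u :+ (x :+ u :+ (u :+ v))) refl (x i) (U (T x) i) (U (T (U (T x))) i))
        (+-congˡ (+-congˡ (sym (UT.+-homo x _ i))))) (q i)))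

      UT³≋UT : ∀ x → U (T (U (T (U (T x))))) ≋ U (T x)
      UT³≋UT x = ≋-trans (UTUT≋UT _) (UTUT≋UT x)

      weak : IsWeakIsometry a b (T ∘ U ∘ T) (U ∘ T ∘ U)
      weak = record
        { T-linear = ∘-linear T-linear UT-linear
        ; U-linear = ∘-linear UT-linear U-linear
        ; adjoint  = λ x y → trans (adjoint _ y) (UT-selfAdjoint x (U y))
        ; T-quad   = λ x → trans (T-quad _) (UT-quad x)
        ; U-quad   = λ y → trans (UT-quad (U y)) (U-quad y)
        }

      improved : Defect.Improvement A B weak
      improved = Defect.improve₂ A B weak a-nondeg b-nondeg
        (λ x → T.cong (≋-trans (UTUT≋UT _) (UT³≋UT x)))
        (λ y → ≋-trans (UTUT≋UT _) (UT³≋UT (U y)))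
        z (λ p → z-notFixed (≋-trans (≋-sym (UT³≋UT z)) p))

    -- Weak isometries are compared by the number of independent vectors fixed by `U ∘ T`, which is
    -- at most `n`. Where one more is impossible, `improve` rules out any vector that is not fixed.
    weakIsometry⇒isometry : ∀ {T U} → IsWeakIsometry a b T U →
                            ∃[ T′ ] ∃[ U′ ] IsWeakIsometry a b T′ U′ × (∀ x → U′ (T′ x) ≋ x)
    weakIsometry⇒isometry {T} {U} w
      with maximal em FixedVectors (λ (_ , _ , _ , _ , indep , _) → independent⇒≤ indep)
             (T , U , w , (λ ()) , (λ _ _ ()) , λ ())
      where
      FixedVectors : ℕ → Set (c ⊔ ℓ₁)
      FixedVectors k = ∃[ T ] ∃[ U ] IsWeakIsometry a b T U ×
        (∃[ v ] Independent {k} {n} v × ∀ j → U (T (v j)) ≋ v j)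
    ... | k , (T₁ , U₁ , w₁ , v , indep , v-fixed) , ¬more with em {P = ∃[ z ] ¬ U₁ (T₁ z) ≋ z}
    ...   | yes (z , z-notFixed) =
      let T₂ , U₂ , w₂ , fixed , y , y-fixed , y-notFixed = improve w₁ z z-notFixed
          module UT = IsLinear (Defect.UT-linear A B w₁)
      in contradiction
        (T₂ , U₂ , w₂ , (y ∷ᵥ v) ,
         -- `y` lies outside the span of `v`, since `U₁ ∘ T₁` is the identity on that span.
         independent-∷ indep (λ x vx≋y → y-notFixed (≋-trans (UT.cong (≋-sym vx≋y))
           (≋-trans (UT.comb-homo x v) (≋-trans (comb-congʳ x v-fixed) vx≋y)))) ,
         λ { zero → y-fixed ; (suc j) → fixed (v j) (v-fixed j) })
        ¬more
    ...   | no ¬p = T₁ , U₁ , w₁ , all-fixed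
      where
      all-fixed : ∀ x → U₁ (T₁ x) ≋ x
      all-fixed x with em {P = U₁ (T₁ x) ≋ x}
      ... | yes q = q
      ... | no ¬q = contradiction (x , ¬q) ¬p

-- Forms in coordinates and totally singular quadratic forms.

module Forms (em : ∀ {ℓ} → ExcludedMiddle ℓ) {c ℓ₁ ℓ₂} (K : HeytingField c ℓ₁ ℓ₂)
             (char2 : HasCharacteristic2 K) where
  open LinearAlgebra em K char2
  open WeakIsometries em K char2
  module Bil = Bilinear {K = K}
  module Quad = Quadratic {K = K}

  -- Row `k` is the image of the `k`-th basis vector, so `M` acts by `x ↦ comb x M`.
  Matrix : ℕ → ℕ → Set c
  Matrix m n = Fin m → Vec n

  -- `B g x x` is definitionally the value at `x` of the quadratic form with coefficients `g`, so
  -- `B` serves both kinds of forms.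
  B : ∀ {n} → Matrix n n → Vec n → Vec n → Carrier
  B g = Bil.⟦ bilinearForm g ⟧

  Q : ∀ {n} → Vec n → Vec n → Carrier
  Q d x = sum λ i → d i * (x i * x i)

  sum-δ′ : ∀ {n} (x : Vec n) i → sum (λ j → x j * δ i j) ≈ x i
  sum-δ′ x i = trans (sum-cong λ j → *-congˡ (δ-sym i j)) (sum-δ x i)

  B-cong : ∀ {n} {g : Matrix n n} {x x′ y y′} → x ≋ x′ → y ≋ y′ → B g x y ≈ B g x′ y′
  B-cong x≋x′ y≋y′ = sum-cong λ i → sum-cong λ j → *-congˡ (*-cong (x≋x′ i) (y≋y′ j))

  B-+-homoˡ : ∀ {n} (g : Matrix n n) x y z → B g (x +ᵥ y) z ≈ B g x z + B g y z
  B-+-homoˡ g x y z = trans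
    (sum-cong λ i → trans
      (sum-cong λ j → solve 4 (λ g x y z → g :* ((x :+ y) :* z) := g :* (x :* z) :+ g :* (y :* z)) refl (g i j) (x i) (y i) (z j))
      (∑-distrib-+ (λ j → g i j * (x i * z j)) (λ j → g i j * (y i * z j))))
    (∑-distrib-+ (λ i → sum λ j → g i j * (x i * z j)) (λ i → sum λ j → g i j * (y i * z j)))

  B-*-homoˡ : ∀ {n} (g : Matrix n n) a x z → B g (a *ᵥ x) z ≈ a * B g x z
  B-*-homoˡ g a x z = trans
    (sum-cong λ i → trans
      (sum-cong λ j → solve 4 (λ g a x z → g :* ((a :* x) :* z) := a :* (g :* (x :* z))) refl (g i j) a (x i) (z j))
      (sym (*-distribˡ-sum a λ j → g i j * (x i * z j))))
    (sym (*-distribˡ-sum a λ i → sum λ j → g i j * (x i * z j)))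

  B-transpose : ∀ {n} (g : Matrix n n) x y → B g x y ≈ B (λ i j → g j i) y x
  B-transpose g x y = trans (∑-comm λ i j → g i j * (x i * y j))
    (sum-cong λ j → sum-cong λ i → *-congˡ (*-comm (x i) (y j)))

  B-+-homoʳ : ∀ {n} (g : Matrix n n) z x y → B g z (x +ᵥ y) ≈ B g z x + B g z y
  B-+-homoʳ g z x y = trans (B-transpose g z _)
    (trans (B-+-homoˡ _ x y z) (sym (+-cong (B-transpose g z x) (B-transpose g z y))))

  B-*-homoʳ : ∀ {n} (g : Matrix n n) a z x → B g z (a *ᵥ x) ≈ a * B g z x
  B-*-homoʳ g a z x = trans (B-transpose g z _)
    (trans (B-*-homoˡ _ a x z) (sym (*-congˡ (B-transpose g z x))))

  functional-comb : ∀ {m n} {ℓ : Vec n → Carrier} → IsFunctional ℓ → (x : Vec m) (v : Matrix m n) →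
                    ℓ (comb x v) ≈ sum λ k → x k * ℓ (v k)
  functional-comb {ℓ = ℓ} ℓ-linear = go
    where
    open IsFunctional ℓ-linear
    go : ∀ {m} (x : Vec m) (v : Matrix m _) → ℓ (comb x v) ≈ sum λ k → x k * ℓ (v k)
    go {zero}  x v = trans (cong λ i → sym (zeroˡ 0#)) (trans (*-homo 0# 0ᵥ) (zeroˡ _))
    go {suc m} x v = trans (+-homo _ _) (+-cong (*-homo _ _) (go (x ∘ suc) (v ∘ suc)))

  B-comb : ∀ {k l n} (g : Matrix n n) (x : Vec k) (v : Matrix k n) (y : Vec l) (w : Matrix l n) →
           B g (comb x v) (comb y w) ≈ sum λ i → sum λ j → B g (v i) (w j) * (x i * y j)
  B-comb g x v y w = begin
    B g (comb x v) (comb y w)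
      ≈⟨ functional-comb functionalˡ x v ⟩
    sum (λ i → x i * B g (v i) (comb y w))
      ≈⟨ sum-cong (λ i → *-congˡ {x i} (functional-comb (functionalʳ i) y w)) ⟩
    sum (λ i → x i * sum λ j → y j * B g (v i) (w j))
      ≈⟨ sum-cong (λ i → trans (*-distribˡ-sum (x i) λ j → y j * B g (v i) (w j))
           (sum-cong λ j → solve 3 (λ x y b → x :* (y :* b) := b :* (x :* y)) refl (x i) (y j) _)) ⟩
    sum (λ i → sum λ j → B g (v i) (w j) * (x i * y j)) ∎
    where
    functionalˡ : IsFunctional λ z → B g z (comb y w)
    functionalˡ = record
      { cong   = λ p → B-cong {g = g} p ≋-refl
      ; +-homo = λ x y → B-+-homoˡ g x y _
      ; *-homo = λ a x → B-*-homoˡ g a x _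
      }

    functionalʳ : ∀ i → IsFunctional (B g (v i))
    functionalʳ i = record
      { cong   = B-cong {g = g} ≋-refl
      ; +-homo = B-+-homoʳ g (v i)
      ; *-homo = λ a → B-*-homoʳ g a (v i)
      }

  B-δˡ : ∀ {n} (g : Matrix n n) k y → B g (δ k) y ≈ sum λ j → g k j * y j
  B-δˡ g k y = trans
    (sum-cong λ i → trans
      (sum-cong λ j → solve 3 (λ g d y → g :* (d :* y) := g :* y :* d) refl (g i j) (δ k i) (y j))
      (sym (*-distribʳ-sum (δ k i) λ j → g i j * y j)))
    (sum-δ′ (λ i → sum λ j → g i j * y j) k)

  B-δʳ : ∀ {n} (g : Matrix n n) x l → B g x (δ l) ≈ sum λ i → g i l * x i
  B-δʳ g x l = trans (B-transpose g x (δ l)) (B-δˡ (λ i j → g j i) l x)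

  B-δδ : ∀ {n} (g : Matrix n n) i j → B g (δ i) (δ j) ≈ g i j
  B-δδ g i j = trans (B-δˡ g i (δ j)) (sum-δ′ (g i) j)

  B-scale : ∀ {n} e (g : Matrix n n) x y → B (λ i j → e * g i j) x y ≈ e * B g x y
  B-scale e g x y = trans
    (sum-cong λ i → trans
      (sum-cong λ j → *-assoc e (g i j) (x i * y j))
      (sym (*-distribˡ-sum e λ j → g i j * (x i * y j))))
    (sym (*-distribˡ-sum e λ i → sum λ j → g i j * (x i * y j)))

  symmetricMatrix : ∀ {n} {g : Matrix n n} → Bil.Symmetric (bilinearForm g) → ∀ i j → g i j ≈ g j i
  symmetricMatrix {g = g} g-sym i j = trans (sym (B-δδ g i j)) (trans (g-sym (δ i) (δ j)) (B-δδ g j i))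

  B-symmetricBilinear : ∀ {n} {g : Matrix n n} → (∀ i j → g i j ≈ g j i) → IsSymmetricBilinear (B g)
  B-symmetricBilinear {g = g} g-sym = record
    { cong   = B-cong
    ; symm   = λ x y → trans (B-transpose g x y) (sum-cong λ i → sum-cong λ j → *-congʳ (g-sym j i))
    ; +-homo = B-+-homoˡ g
    ; *-homo = B-*-homoˡ g
    }

  -- The terms at `(i, j)` and `(j, i)` cancel; the induction splits off the first row and column.
  sum-alternating : ∀ {n} (s : Matrix n n) → (∀ i j → ¬ i ≡ j → s i j + s j i ≈ 0#) →
                    sum (λ i → sum (s i)) ≈ sum λ i → s i i
  sum-alternating {zero}  s s-alt = refl
  sum-alternating {suc n} s s-alt = begin
    s zero zero + p + sum (λ i → s (suc i) zero + sum (s (suc i) ∘ suc))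
      ≈⟨ +-congˡ (∑-distrib-+ (λ i → s (suc i) zero) (λ i → sum (s (suc i) ∘ suc))) ⟩
    s zero zero + p + (q + r)
      ≈⟨ solve 4 (λ o p q r → o :+ p :+ (q :+ r) := o :+ ((p :+ q) :+ r)) refl _ p q r ⟩
    s zero zero + (p + q + r)
      ≈⟨ +-congˡ (+-cong p+q≈0 (sum-alternating (λ i j → s (suc i) (suc j)) λ i j i≢j → s-alt (suc i) (suc j) (i≢j ∘ Fin.suc-injective))) ⟩
    s zero zero + (0# + sum λ i → s (suc i) (suc i))
      ≈⟨ +-congˡ (+-identityˡ _) ⟩
    s zero zero + sum (λ i → s (suc i) (suc i)) ∎
    where
    p = sum λ j → s zero (suc j)
    q = sum λ i → s (suc i) zero
    r = sum λ i → sum (s (suc i) ∘ suc)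

    p+q≈0 : p + q ≈ 0#
    p+q≈0 = trans (sym (∑-distrib-+ (λ j → s zero (suc j)) (λ i → s (suc i) zero)))
      (sum-zero _ λ j → s-alt zero (suc j) λ ())

  -- The hypothesis covers symmetric matrices, by characteristic 2, and the coefficients of totally
  -- singular forms; both halves of the theorem reach `Q` this way.
  B-diagonal : ∀ {n} {g : Matrix n n} → (∀ i j → ¬ i ≡ j → g i j + g j i ≈ 0#) →
               ∀ x → B g x x ≈ Q (λ i → g i i) x
  B-diagonal {g = g} g-alt x = sum-alternating (λ i j → g i j * (x i * x j)) λ i j i≢j → begin
    g i j * (x i * x j) + g j i * (x j * x i)
      ≈⟨ solve 4 (λ g h x y → g :* (x :* y) :+ h :* (y :* x) := (g :+ h) :* (x :* y)) refl (g i j) (g j i) (x i) (x j) ⟩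
    (g i j + g j i) * (x i * x j) ≈⟨ *-congʳ (g-alt i j i≢j) ⟩
    0# * (x i * x j)              ≈⟨ zeroˡ _ ⟩
    0#                            ∎

  -- Coordinate-free total singularity: zero polar form and scaling by squares.
  record IsTotallySingular {n} (q : Vec n → Carrier) : Set (c ⊔ ℓ₁) where
    field
      cong   : ∀ {x y} → x ≋ y → q x ≈ q y
      +-homo : ∀ x y → q (x +ᵥ y) ≈ q x + q y
      *-homo : ∀ a x → q (a *ᵥ x) ≈ a * a * q x

    comb-homo : ∀ {m} (x : Vec m) (v : Matrix m n) → q (comb x v) ≈ sum λ k → q (v k) * (x k * x k)
    comb-homo {zero}  x v = trans (cong λ i → sym (zeroˡ 0#)) (trans (*-homo 0# 0ᵥ) (trans (*-congʳ (zeroˡ _)) (zeroˡ _)))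
    comb-homo {suc m} x v = trans (+-homo _ _) (+-cong (trans (*-homo _ _) (*-comm _ _)) (comb-homo (x ∘ suc) (v ∘ suc)))

  Q-totallySingular : ∀ {n} (d : Vec n) → IsTotallySingular (Q d)
  Q-totallySingular d = record
    { cong   = λ x≋y → sum-cong λ i → *-congˡ (*-cong (x≋y i) (x≋y i))
    ; +-homo = λ x y → trans
        (sum-cong λ i → solve 3 (λ d x y → d :* ((x :+ y) :* (x :+ y)) := d :* (x :* x) :+ d :* (y :* y)) refl (d i) (x i) (y i))
        (∑-distrib-+ (λ i → d i * (x i * x i)) (λ i → d i * (y i * y i)))
    ; *-homo = λ a x → trans
        (sum-cong λ i → solve 3 (λ d a x → d :* (a :* x :* (a :* x)) := a :* a :* (d :* (x :* x))) refl (d i) a (x i))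
        (sym (*-distribˡ-sum (a * a) λ i → d i * (x i * x i)))
    }

  -- The sum `a i j + a j i` is the polar form at two basis vectors. It vanishes because the form is
  -- a diagonal one composed with an additive map, hence additive.
  totallySingular⇒polar≈0 : ∀ {n} {a : Matrix n n} → Quad.TotallySingular (quadraticForm a) →
                            ∀ i j → ¬ i ≡ j → a i j + a j i ≈ 0#
  totallySingular⇒polar≈0 {n} {a} (d , T , T-iso , isometric) i j _ = begin
    a i j + a j i
      ≈⟨ +-cong (B-δδ a i j) (B-δδ a j i) ⟨
    B a (δ i) (δ j) + B a (δ j) (δ i)
      -- The diagonal values are added twice to complete the expansion of `B a` at `δ i +ᵥ δ j`.
      ≈⟨ solve 4 (λ p q r s → q :+ r := p :+ q :+ (r :+ s) :+ (p :+ s)) refl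
           (B a (δ i) (δ i)) (B a (δ i) (δ j)) (B a (δ j) (δ i)) (B a (δ j) (δ j)) ⟩
    B a (δ i) (δ i) + B a (δ i) (δ j) + (B a (δ j) (δ i) + B a (δ j) (δ j)) + (B a (δ i) (δ i) + B a (δ j) (δ j))
      ≈⟨ +-congʳ (trans (B-+-homoˡ a (δ i) (δ j) _) (+-cong (B-+-homoʳ a _ _ _) (B-+-homoʳ a _ _ _))) ⟨
    B a (δ i +ᵥ δ j) (δ i +ᵥ δ j) + (B a (δ i) (δ i) + B a (δ j) (δ j))
      ≈⟨ +-congʳ (additive (δ i) (δ j)) ⟩
    B a (δ i) (δ i) + B a (δ j) (δ j) + (B a (δ i) (δ i) + B a (δ j) (δ j))
      ≈⟨ x+x≈0 _ ⟩
    0# ∎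
    where
    open IsLeftModuleIsomorphism T-iso using (+ᴹ-homo)
    D : Matrix n n
    D i j = if does (i Fin.≟ j) then d i else 0#

    D-off : ∀ {i j} → ¬ i ≡ j → D i j ≈ 0#
    D-off {i} {j} i≢j = reflexive (≡.cong (if_then d i else 0#) (dec-false (i Fin.≟ j) i≢j))

    q : Vec n → Carrier
    q = Q λ i → D i i
    module q = IsTotallySingular (Q-totallySingular λ i → D i i)

    B≈q : ∀ x → B a x x ≈ q (T x)
    B≈q x = trans (sym (isometric x))
      (B-diagonal (λ i j i≢j → trans (+-cong (D-off i≢j) (D-off (i≢j ∘ ≡.sym))) (+-identityˡ 0#)) (T x))

    additive : ∀ x y → B a (x +ᵥ y) (x +ᵥ y) ≈ B a x x + B a y y
    additive x y = begin
      B a (x +ᵥ y) (x +ᵥ y)   ≈⟨ B≈q (x +ᵥ y) ⟩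
      q (T (x +ᵥ y))          ≈⟨ q.cong (+ᴹ-homo x y) ⟩
      q (T x +ᵥ T y)          ≈⟨ q.+-homo (T x) (T y) ⟩
      q (T x) + q (T y)       ≈⟨ +-cong (B≈q x) (B≈q y) ⟨
      B a x x + B a y y       ∎

  -- Adding to T a rank one map from a vector of its kernel to a q-isotropic vector outside its
  -- image increases the rank and preserves q ∘ T.
  surjectiveIsometry : ∀ {n} {p q : Vec n → Carrier} → IsTotallySingular q →
    ∀ {T S} → IsLinear T → IsLinear S → (∀ x → q (T x) ≈ p x) → (∀ y → p (S y) ≈ q y) →
    ∃[ T′ ] ∃ λ (T′-linear : IsLinear T′) → (∀ x → q (T′ x) ≈ p x) × Surjective T′-linear
  surjectiveIsometry {n} {p} {q} q-ts {T} {S} T-linear S-linear qT≈p pS≈q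
    with maximal em ImageVectors (λ (_ , _ , _ , _ , indep) → independent⇒≤ indep)
           (T , T-linear , qT≈p , (λ ()) , (λ _ _ ()))
    where
    ImageVectors : ℕ → Set (c ⊔ ℓ₁)
    ImageVectors k = ∃[ T ] IsLinear T × (∀ x → q (T x) ≈ p x) ×
      (∃[ z ] Independent {k} {n} (T ∘ z))
  ... | k , (T₁ , T₁-linear , qT₁≈p , z , indep) , ¬more with em {P = ∃[ y ] ¬ (∃[ x ] T₁ x ≋ y)}
  ...   | no ¬p = T₁ , T₁-linear , qT₁≈p , surj
    where
    surj : Surjective T₁-linear
    surj y with em {P = ∃[ x ] T₁ x ≋ y}
    ... | yes r = r
    ... | no ¬r = contradiction (y , ¬r) ¬p
  ...   | yes (y , y∉im) with em {P = ∃[ x ] T₁ x ≋ 0ᵥ × ¬ x ≋ 0ᵥ}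
  ...     | no ¬p = contradiction (injective⇒surjective T₁-linear (λ {x} → inj x) y) y∉im
    where
    inj : ∀ x → T₁ x ≋ 0ᵥ → x ≋ 0ᵥ
    inj x Tx≋0 with em {P = x ≋ 0ᵥ}
    ... | yes r = r
    ... | no ¬r = contradiction (x , Tx≋0 , ¬r) ¬p
  ...     | yes (x , Tx≋0 , x≉0) with ≉⇒∃≉0 x≉0
  ...       | j , xⱼ≉0 with inverse xⱼ≉0
  ...         | a , axⱼ≈1 = contradiction
    (T₂ , T₂-linear , qT₂≈p , (x ∷ᵥ λ i → z i +ᵥ ℓ (z i) *ᵥ x) , independent₂) ¬more
    where
    module T₁ = IsLinear T₁-linear
    module q = IsTotallySingular q-ts

    -- `q (T₁ (S y))` equals `q y`, so the sum is isotropic; it stays outside the image because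
    -- `T₁ (S y)` is inside.
    y′ : Vec n
    y′ = y +ᵥ T₁ (S y)

    qy′≈0 : q y′ ≈ 0#
    qy′≈0 = trans (q.+-homo y _) (trans (+-congˡ (trans (qT₁≈p (S y)) (pS≈q y))) (x+x≈0 _))

    y′∉im : ∀ w → ¬ T₁ w ≋ y′
    y′∉im w Tw≋y′ = y∉im (w +ᵥ S y , λ i → trans (T₁.+-homo w _ i) (trans (+-congʳ (Tw≋y′ i))
      (solve 2 (λ y t → y :+ t :+ t := y) refl _ _)))

    -- `ℓ x` is 1 by the choice of `a`, so that `T₂` sends the kernel vector `x` to `y′`.
    ℓ : Vec n → Carrier
    ℓ w = a * w j

    ℓ-linear : IsFunctional ℓ
    ℓ-linear = record
      { cong   = λ v≋w → *-congˡ (v≋w j)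
      ; +-homo = λ v w → distribˡ a _ _
      ; *-homo = λ b w → solve 3 (λ a b w → a :* (b :* w) := b :* (a :* w)) refl a b (w j)
      }

    T₂ : Vec n → Vec n
    T₂ w = T₁ w +ᵥ ℓ w *ᵥ y′

    T₂-linear : IsLinear T₂
    T₂-linear = +-linear T₁-linear (functional-linear ℓ-linear y′)

    qT₂≈p : ∀ w → q (T₂ w) ≈ p w
    qT₂≈p w = trans (q.+-homo (T₁ w) _) (trans
      (+-cong (qT₁≈p w) (trans (q.*-homo (ℓ w) y′) (trans (*-congˡ qy′≈0) (zeroʳ _)))) (+-identityʳ _))

    T₂-head : T₂ x ≋ y′
    T₂-head i = trans (+-cong (Tx≋0 i) (trans (*-congʳ axⱼ≈1) (*-identityˡ _))) (+-identityˡ _)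

    -- `ℓ` vanishes at `w +ᵥ ℓ w *ᵥ x` and `T₁` kills `x`, so the old image vectors are still
    -- reached.
    T₂-tail : ∀ w → T₂ (w +ᵥ ℓ w *ᵥ x) ≋ T₁ w
    T₂-tail w i = begin
      T₁ (w +ᵥ ℓ w *ᵥ x) i + a * (w j + a * w j * x j) * y′ i
        ≈⟨ +-cong (trans (T₁.+-homo w _ i) (+-congˡ (trans (T₁.*-homo (ℓ w) x i) (*-congˡ (Tx≋0 i)))))
             (solve 4 (λ a w x y → a :* (w :+ a :* w :* x) :* y := (a :* w :+ (a :* w) :* (a :* x)) :* y) refl a (w j) (x j) (y′ i)) ⟩
      T₁ w i + ℓ w * 0# + (a * w j + a * w j * (a * x j)) * y′ i
        ≈⟨ +-congˡ (*-congʳ (+-congˡ (*-congˡ axⱼ≈1))) ⟩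
      T₁ w i + ℓ w * 0# + (a * w j + a * w j * 1#) * y′ i
        ≈⟨ solve 3 (λ t l y → t :+ l :* con false :+ (l :+ l :* con true) :* y := t) refl (T₁ w i) (ℓ w) (y′ i) ⟩
      T₁ w i ∎

    independent₂ : Independent (T₂ ∘ (x ∷ᵥ λ i → z i +ᵥ ℓ (z i) *ᵥ x))
    independent₂ t t-comb = independent-∷ {v = T₁ ∘ z} {y′} indep
      (λ t Tz≋y′ → y′∉im (comb t z) (≋-trans (T₁.comb-homo t z) Tz≋y′)) t
      (≋-trans (comb-congʳ t {y′ ∷ᵥ (T₁ ∘ z)} {T₂ ∘ (x ∷ᵥ λ i → z i +ᵥ ℓ (z i) *ᵥ x)} λ
        { zero    → ≋-sym T₂-head
        ; (suc i) → ≋-sym (T₂-tail (z i))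
        }) t-comb)

-- Similarities expressed by matrices.

module Similarities (em : ∀ {ℓ} → ExcludedMiddle ℓ) {c ℓ₁ ℓ₂} (K : HeytingField c ℓ₁ ℓ₂)
                    (char2 : HasCharacteristic2 K) where
  open LinearAlgebra em K char2
  open WeakIsometries em K char2
  open Forms em K char2

  comb-δˡ : ∀ {m n} k (v : Matrix m n) → comb (δ k) v ≋ v k
  comb-δˡ k v i = trans (sum-cong λ j → *-comm (δ k j) (v j i)) (sum-δ′ (λ j → v j i) k)

  comb-comb : ∀ {l m n} (x : Vec l) (v : Matrix l m) (w : Matrix m n) →
              comb (comb x v) w ≋ comb x (λ i → comb (v i) w)
  comb-comb x v w = IsLinear.comb-homo (comb-linear w) x v

  AreInverse : ∀ {m n} → Matrix m n → Matrix n m → Set ℓ₁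
  AreInverse M N = (∀ l → comb (N l) M ≋ δ l) × (∀ k → comb (M k) N ≋ δ k)

  inverse-comb : ∀ {m n} {M : Matrix m n} {N : Matrix n m} → (∀ k → comb (M k) N ≋ δ k) →
                 ∀ x → comb (comb x M) N ≋ x
  inverse-comb {M = M} {N} NM x = ≋-trans (comb-comb x M N) (≋-trans (comb-congʳ x NM) (comb-δ x))

  areInverse⇒≡ : ∀ {m n} {M : Matrix m n} {N : Matrix n m} → AreInverse M N → m ≡ n
  areInverse⇒≡ {M = M} {N} (MN , NM) = ℕ.≤-antisym (leftInvertible⇒≤ {M = M} {N} NM) (leftInvertible⇒≤ {M = N} {M} MN)
    where
    leftInvertible⇒≤ : ∀ {m n} {M : Matrix m n} {N : Matrix n m} → (∀ k → comb (M k) N ≋ δ k) → m ≤ n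
    leftInvertible⇒≤ {M = M} {N} NM = injective⇒≤ (comb-linear M) λ {x} Mx≋0 →
      ≋-trans (≋-sym (inverse-comb {M = M} {N} NM x)) (IsLinear.0-homo (comb-linear N) Mx≋0)

  isomorphism : ∀ {m n} {T : Vec m → Vec n} (T-linear : IsLinear T) → Injective T-linear → Surjective T-linear →
                IsLeftModuleIsomorphism (coordinateSpace K m) (coordinateSpace K n) T
  isomorphism {T = T} T-linear inj surj = record
    { isLeftModuleMonomorphism = record
      { isLeftModuleHomomorphism = record
        { +ᴹ-isGroupHomomorphism = record
          { isMonoidHomomorphism = record
            { isMagmaHomomorphism = record
              { isRelHomomorphism = record { cong = T.cong }
              ; homo              = T.+-homo
              }
            ; ε-homo = T.0-homo λ _ → refl
            }
          ; ⁻¹-homo = λ x → ≋-trans (T.cong λ i → -x≈x (x i)) λ i → sym (-x≈x (T x i))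
          }
        ; *ₗ-homo = T.*-homo
        }
      ; injective = λ {x} {y} Tx≋Ty i → x+y≈0⇒x≈y (inj {x +ᵥ y}
          (λ i → trans (T.+-homo x y i) (trans (+-congʳ (Tx≋Ty i)) (x+x≈0 _))) i)
      }
    ; surjective = λ y → let x , Tx≋y = surj y in x , λ z≋x → ≋-trans (T.cong z≋x) Tx≋y
    }
    where module T = IsLinear T-linear

  comb-isomorphism : ∀ {m n} {M : Matrix m n} {N : Matrix n m} → AreInverse M N →
                     IsLeftModuleIsomorphism (coordinateSpace K m) (coordinateSpace K n) (λ x → comb x M)
  comb-isomorphism {M = M} {N} (MN , NM) = isomorphism (comb-linear M)
    (λ {x} Mx≋0 → ≋-trans (≋-sym (inverse-comb {M = M} {N} NM x)) (IsLinear.0-homo (comb-linear N) Mx≋0))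
    (λ y → comb y N , inverse-comb {M = N} {M} MN y)

  module Isomorphism {m n} {T : Vec m → Vec n}
                     (T-iso : IsLeftModuleIsomorphism (coordinateSpace K m) (coordinateSpace K n) T) where
    private module T = IsLeftModuleIsomorphism T-iso

    linear : IsLinear T
    linear = record { cong = T.⟦⟧-cong ; +-homo = T.+ᴹ-homo ; *-homo = T.*ₗ-homo }

    matrix : Matrix m n
    matrix = T ∘ δ

    inverseMatrix : Matrix n m
    inverseMatrix l = proj₁ (T.surjective (δ l))

    T-inverseMatrix : ∀ l → T (inverseMatrix l) ≋ δ l
    T-inverseMatrix l = proj₂ (T.surjective (δ l)) ≋-refl

    areInverse : AreInverse matrix inverseMatrix
    areInverse = (λ l → ≋-trans (≋-sym (IsLinear.expand linear _)) (T-inverseMatrix l))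
      , λ k → T.injective (≋-trans (IsLinear.comb-homo linear (T (δ k)) inverseMatrix)
          (≋-trans (comb-congʳ (T (δ k)) T-inverseMatrix) (comb-δ (T (δ k)))))

  Q-δ : ∀ {n} (d : Vec n) k → Q d (δ k) ≈ d k
  Q-δ d k = begin
    sum (λ i → d i * (δ k i * δ k i)) ≈⟨ sum-cong (λ i → *-assoc (d i) (δ k i) (δ k i)) ⟨
    sum (λ i → d i * δ k i * δ k i)   ≈⟨ sum-δ′ (λ i → d i * δ k i) k ⟩
    d k * δ k k                       ≈⟨ *-congˡ (δ-diag k) ⟩
    d k * 1#                          ≈⟨ *-identityʳ (d k) ⟩
    d k                               ∎
    where
    δ-diag : ∀ {n} (k : Fin n) → δ k k ≈ 1#
    δ-diag zero    = refl
    δ-diag (suc k) = δ-diag k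

  Q-comb : ∀ {m n} (d : Vec n) (x : Vec m) (v : Matrix m n) →
           Q d (comb x v) ≈ sum λ k → Q d (v k) * (x k * x k)
  Q-comb d = IsTotallySingular.comb-homo (Q-totallySingular d)

  Q-comb-scale : ∀ {m n} {e e′} {d : Vec m} {d′ : Vec n} {M : Matrix m n} → (∀ k → e * Q d′ (M k) ≈ e′ * d k) →
                 ∀ x → e * Q d′ (comb x M) ≈ e′ * Q d x
  Q-comb-scale {e = e} {e′} {d} {d′} {M} eQM≈e′d x = begin
    e * Q d′ (comb x M)                       ≈⟨ *-congˡ (Q-comb d′ x M) ⟩
    e * sum (λ k → Q d′ (M k) * (x k * x k))  ≈⟨ *-distribˡ-sum e (λ k → Q d′ (M k) * (x k * x k)) ⟩
    sum (λ k → e * (Q d′ (M k) * (x k * x k))) ≈⟨ sum-cong (λ k → trans (sym (*-assoc e _ _))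
                                                   (trans (*-congʳ (eQM≈e′d k)) (*-assoc e′ _ _))) ⟩
    sum (λ k → e′ * (d k * (x k * x k)))      ≈⟨ *-distribˡ-sum e′ (λ k → d k * (x k * x k)) ⟨
    e′ * Q d x                                ∎

  B-comb-scale : ∀ {m n} {e} {g : Matrix m m} {h : Matrix n n} {M : Matrix m n} →
                 (∀ k l → e * B h (M k) (M l) ≈ g k l) → ∀ x y → e * B h (comb x M) (comb y M) ≈ B g x y
  B-comb-scale {e = e} {g} {h} {M} eBM≈g x y = begin
    e * B h (comb x M) (comb y M)                           ≈⟨ *-congˡ (B-comb h x M y M) ⟩
    e * B (λ k l → B h (M k) (M l)) x y                     ≈⟨ B-scale e (λ k l → B h (M k) (M l)) x y ⟨
    B (λ k l → e * B h (M k) (M l)) x y                     ≈⟨ sum-cong (λ k → sum-cong λ l → *-congʳ (eBM≈g k l)) ⟩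
    B g x y                                                 ∎

  Alternating Symmetric : ∀ {n} → Matrix n n → Set ℓ₁
  Alternating g = ∀ i j → ¬ i ≡ j → g i j + g j i ≈ 0#
  Symmetric   g = ∀ i j → g i j ≈ g j i

  symmetric⇒alternating : ∀ {n} {g : Matrix n n} → Symmetric g → Alternating g
  symmetric⇒alternating g-sym i j _ = trans (+-congʳ (g-sym i j)) (x+x≈0 _)

  diag : ∀ {n} → Matrix n n → Vec n
  diag g i = g i i

  -- Testing on basis vectors suffices, because `Q d′` is additive and scales by squares.
  MatrixSimilarQ : ∀ {m n} → Vec m → Vec n → Set (c ⊔ ℓ₁)
  MatrixSimilarQ {m} {n} d d′ = ∃[ e ] ¬ e ≈ 0# × (∃[ M ] ∃[ N ] AreInverse {m} {n} M N ×
    ∀ k → e * Q d′ (M k) ≈ d k)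

  MatrixSimilarB : ∀ {m n} → Matrix m m → Matrix n n → Set (c ⊔ ℓ₁)
  MatrixSimilarB {m} {n} g h = ∃[ e ] ¬ e ≈ 0# × (∃[ M ] ∃[ N ] AreInverse {m} {n} M N ×
    ∀ k l → e * B h (M k) (M l) ≈ g k l)

  scaledQ : ∀ {n} e {b : Matrix n n} → Alternating b → ∀ x →
            Quad.⟦ Quad.scale e (quadraticForm b) ⟧ x ≈ e * Q (diag b) x
  scaledQ e {b} b-alt x = trans (B-scale e b x x) (*-congˡ (B-diagonal {g = b} b-alt x))

  similarQ⇒matrix : ∀ {m n} {a : Matrix m m} {b : Matrix n n} → Alternating a → Alternating b →
                    Quad.Similar (quadraticForm a) (quadraticForm b) → MatrixSimilarQ (diag a) (diag b)
  similarQ⇒matrix {a = a} {b} a-alt b-alt (e , e#0 , T , T-iso , isometric) =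
    e , #⇒≉ e#0 , matrix , inverseMatrix , areInverse , λ k → begin
      e * Q (diag b) (T (δ k))                        ≈⟨ scaledQ e {b} b-alt (T (δ k)) ⟨
      Quad.⟦ Quad.scale e (quadraticForm b) ⟧ (T (δ k)) ≈⟨ isometric (δ k) ⟩
      B a (δ k) (δ k)                                 ≈⟨ B-δδ a k k ⟩
      a k k                                           ∎
    where open Isomorphism T-iso

  matrix⇒similarQ : ∀ {m n} {a : Matrix m m} {b : Matrix n n} → Alternating a → Alternating b →
                    MatrixSimilarQ (diag a) (diag b) → Quad.Similar (quadraticForm a) (quadraticForm b)
  matrix⇒similarQ {a = a} {b} a-alt b-alt (e , e≉0 , M , N , inv , eQM≈d) =
    e , ≉⇒# e≉0 , (λ x → comb x M) , comb-isomorphism {M = M} {N} inv , λ x → begin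
      Quad.⟦ Quad.scale e (quadraticForm b) ⟧ (comb x M)
        ≈⟨ scaledQ e {b} b-alt (comb x M) ⟩
      e * Q (diag b) (comb x M)
        ≈⟨ Q-comb-scale {e′ = 1#} {diag a} {diag b} {M} (λ k → trans (eQM≈d k) (sym (*-identityˡ _))) x ⟩
      1# * Q (diag a) x
        ≈⟨ *-identityˡ _ ⟩
      Q (diag a) x
        ≈⟨ B-diagonal {g = a} a-alt x ⟨
      B a x x ∎

  similarB⇒matrix : ∀ {m n} {g : Matrix m m} {h : Matrix n n} →
                    Bil.Similar (bilinearForm g) (bilinearForm h) → MatrixSimilarB g h
  similarB⇒matrix {g = g} {h} (e , e#0 , T , T-iso , isometric) =
    e , #⇒≉ e#0 , matrix , inverseMatrix , areInverse , λ k l → begin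
      e * B h (T (δ k)) (T (δ l))           ≈⟨ B-scale e h (T (δ k)) (T (δ l)) ⟨
      B (λ i j → e * h i j) (T (δ k)) (T (δ l)) ≈⟨ isometric (δ k) (δ l) ⟩
      B g (δ k) (δ l)                       ≈⟨ B-δδ g k l ⟩
      g k l                                 ∎
    where open Isomorphism T-iso

  matrix⇒similarB : ∀ {m n} {g : Matrix m m} {h : Matrix n n} →
                    MatrixSimilarB g h → Bil.Similar (bilinearForm g) (bilinearForm h)
  matrix⇒similarB {g = g} {h} (e , e≉0 , M , N , inv , eBM≈g) =
    e , ≉⇒# e≉0 , (λ x → comb x M) , comb-isomorphism {M = M} {N} inv , λ x y →
      trans (B-scale e h (comb x M) (comb y M)) (B-comb-scale {g = g} {h} {M} eBM≈g x y)

  matrixSimilarB⇒Q : ∀ {m n e} {g : Matrix m m} {h : Matrix n n} {M : Matrix m n} → Symmetric h →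
                     (∀ k l → e * B h (M k) (M l) ≈ g k l) → ∀ k → e * Q (diag h) (M k) ≈ diag g k
  matrixSimilarB⇒Q {h = h} {M} h-sym eBM≈g k =
    trans (*-congˡ (sym (B-diagonal {g = h} (symmetric⇒alternating {g = h} h-sym) (M k)))) (eBM≈g k k)

  -- Linear in `γ` and the squares of the entries of `X` and `Y`, with coefficients from the two
  -- forms.
  WeakSimilarityQ : ∀ {m n} → Vec m → Vec n → Carrier → Matrix m n → Matrix n m → Set ℓ₁
  WeakSimilarityQ d d′ γ X Y = (∀ k → Q d′ (X k) ≈ γ * d k) × (∀ l → Q d (Y l) ≈ γ * d′ l)

  -- The identity `B h (X k) (δ l) ≈ B g (δ k) (Y l)` in coordinates, linear in the entries of `X`
  -- and `Y`.
  Adjoint : ∀ {m n} → Matrix m m → Matrix n n → Matrix m n → Matrix n m → Set ℓ₁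
  Adjoint g h X Y = ∀ k l → sum (λ i → h i l * X k i) ≈ sum (λ j → g k j * Y l j)

  -- `M` multiplies the form by the inverse of `e`; scaling it by `e` turns this into `e`, the
  -- factor that `N` already has.
  similarity⇒weakQ : ∀ {m n e} {d : Vec m} {d′ : Vec n} {M : Matrix m n} {N : Matrix n m} → AreInverse M N →
                     (∀ k → e * Q d′ (M k) ≈ d k) → WeakSimilarityQ d d′ e (λ k → e *ᵥ M k) N
  similarity⇒weakQ {e = e} {d} {d′} {M} {N} (MN , NM) eQM≈d = (λ k → begin
      Q d′ (e *ᵥ M k)      ≈⟨ IsTotallySingular.*-homo (Q-totallySingular d′) e (M k) ⟩
      e * e * Q d′ (M k)   ≈⟨ *-assoc e e _ ⟩
      e * (e * Q d′ (M k)) ≈⟨ *-congˡ (eQM≈d k) ⟩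
      e * d k              ∎)
    , λ l → begin
      Q d (N l)               ≈⟨ *-identityˡ _ ⟨
      1# * Q d (N l)          ≈⟨ Q-comb-scale {e′ = 1#} {d} {d′} {M} (λ k → trans (eQM≈d k) (sym (*-identityˡ _))) (N l) ⟨
      e * Q d′ (comb (N l) M) ≈⟨ *-congˡ (IsTotallySingular.cong (Q-totallySingular d′) (MN l)) ⟩
      e * Q d′ (δ l)          ≈⟨ *-congˡ (Q-δ d′ l) ⟩
      e * d′ l                ∎

  -- The similarity identity at the vectors `δ k` and `N l`, where `M` takes `N l` to `δ l`.
  similarity⇒adjoint : ∀ {m n e} {g : Matrix m m} {h : Matrix n n} {M : Matrix m n} {N : Matrix n m} →
                       AreInverse M N → (∀ k l → e * B h (M k) (M l) ≈ g k l) → Adjoint g h (λ k → e *ᵥ M k) N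
  similarity⇒adjoint {e = e} {g} {h} {M} {N} (MN , NM) eBM≈g k l = begin
    sum (λ i → h i l * (e * M k i))         ≈⟨ B-δʳ h (e *ᵥ M k) l ⟨
    B h (e *ᵥ M k) (δ l)                    ≈⟨ B-*-homoˡ h e (M k) (δ l) ⟩
    e * B h (M k) (δ l)                     ≈⟨ *-congˡ (B-cong (comb-δˡ k M) (MN l)) ⟨
    e * B h (comb (δ k) M) (comb (N l) M)   ≈⟨ B-comb-scale {g = g} {h} {M} eBM≈g (δ k) (N l) ⟩
    B g (δ k) (N l)                         ≈⟨ B-δˡ g k (N l) ⟩
    sum (λ j → g k j * N l j)               ∎

  -- With `scaling` the inverse of `γ`, the maps given by `X` and by `scaling` times `Y` go back and
  -- forth between `Q d` and `scaling * Q d′` and preserve these forms.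
  module Rescaled {n γ} (d d′ : Vec n) (X Y : Matrix n n) (γ≉0 : ¬ γ ≈ 0#) (weak : WeakSimilarityQ d d′ γ X Y) where
    scaling : Carrier
    scaling = proj₁ (inverse γ≉0)

    scaling≉0 : ¬ scaling ≈ 0#
    scaling≉0 e≈0 = 1≉0 (trans (sym (proj₂ (inverse γ≉0))) (trans (*-congʳ e≈0) (zeroˡ γ)))

    X-quad : ∀ x → scaling * Q d′ (comb x X) ≈ Q d x
    X-quad x = trans (Q-comb-scale {e′ = 1#} {d} {d′} {X} (λ k → trans (*-congˡ (proj₁ weak k))
      (trans (sym (*-assoc _ γ _)) (*-congʳ (proj₂ (inverse γ≉0))))) x) (*-identityˡ _)

    Y-quad : ∀ y → Q d (scaling *ᵥ comb y Y) ≈ scaling * Q d′ y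
    Y-quad y = begin
      Q d (scaling *ᵥ comb y Y)              ≈⟨ IsTotallySingular.*-homo (Q-totallySingular d) scaling _ ⟩
      scaling * scaling * Q d (comb y Y)     ≈⟨ *-assoc _ _ _ ⟩
      scaling * (scaling * Q d (comb y Y))   ≈⟨ *-congˡ (Q-comb-scale {e′ = 1#} {d′} {d} {Y} (λ l → trans (*-congˡ (proj₂ weak l))
                                                  (trans (sym (*-assoc _ γ _)) (*-congʳ (proj₂ (inverse γ≉0))))) y) ⟩
      scaling * (1# * Q d′ y)                ≈⟨ *-congˡ (*-identityˡ _) ⟩
      scaling * Q d′ y                       ∎

    Y-linear : IsLinear (λ y → scaling *ᵥ comb y Y)
    Y-linear = record
      { cong   = λ p i → *-congˡ (Y.cong p i)
      ; +-homo = λ x y i → trans (*-congˡ (Y.+-homo x y i)) (distribˡ _ _ _)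
      ; *-homo = λ a x i → trans (*-congˡ (Y.*-homo a x i))
          (solve 3 (λ s a y → s :* (a :* y) := a :* (s :* y)) refl scaling a _)
      }
      where module Y = IsLinear (comb-linear Y)

  scaledTotallySingular : ∀ {n} e (d : Vec n) → IsTotallySingular (λ x → e * Q d x)
  scaledTotallySingular e d = record
    { cong   = λ p → *-congˡ (q.cong p)
    ; +-homo = λ x y → trans (*-congˡ (q.+-homo x y)) (distribˡ e _ _)
    ; *-homo = λ a x → trans (*-congˡ (q.*-homo a x)) (solve 3 (λ e a q → e :* (a :* a :* q) := a :* a :* (e :* q)) refl e a _)
    }
    where module q = IsTotallySingular (Q-totallySingular d)

  scaledSymmetricBilinear : ∀ {n} e {h : Matrix n n} → Symmetric h → IsSymmetricBilinear (λ x y → e * B h x y)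
  scaledSymmetricBilinear e {h} h-sym = record
    { cong   = λ p q → *-congˡ (b.cong p q)
    ; symm   = λ x y → *-congˡ (b.symm x y)
    ; +-homo = λ x y z → trans (*-congˡ (b.+-homo x y z)) (distribˡ e _ _)
    ; *-homo = λ a x z → trans (*-congˡ (b.*-homo a x z)) (solve 3 (λ e a b → e :* (a :* b) := a :* (e :* b)) refl e a _)
    }
    where module b = IsSymmetricBilinear (B-symmetricBilinear {g = h} h-sym)

  -- `surjectiveIsometry` replaces the map of `X` by a surjective one, which is an isomorphism as
  -- both sides have dimension `n`.
  weak⇒similarQ : ∀ {n γ} {a b : Matrix n n} (X Y : Matrix n n) → Alternating a → Alternating b → ¬ γ ≈ 0# →
                  WeakSimilarityQ (diag a) (diag b) γ X Y → Quad.Similar (quadraticForm a) (quadraticForm b)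
  weak⇒similarQ {n} {γ} {a} {b} X Y a-alt b-alt γ≉0 weak =
    let T , T-linear , isometric , surj = surjectiveIsometry {p = Q (diag a)}
          (scaledTotallySingular scaling (diag b)) (comb-linear X) Y-linear X-quad Y-quad
        S , S-linear , _ , ST≋id = surjective⇒inverse T-linear surj
    in scaling , ≉⇒# scaling≉0 , T ,
      isomorphism T-linear (λ {x} Tx≋0 → ≋-trans (≋-sym (ST≋id x)) (IsLinear.0-homo S-linear Tx≋0)) surj ,
      λ x → trans (scaledQ scaling {b} b-alt (T x)) (trans (isometric x) (sym (B-diagonal {g = a} a-alt x)))
    where
    open Rescaled {γ = γ} (diag a) (diag b) X Y γ≉0 weak

  -- After rescaling, `X` and `Y` give a weak isometry: `B g x x` is `Q (diag g) x` for symmetric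
  -- `g`, which supplies its quadratic conditions.
  weak⇒similarB : ∀ {n γ} {g h : Matrix n n} (X Y : Matrix n n) → Symmetric g → Symmetric h →
                  Bil.Nonsingular (bilinearForm g) → Bil.Nonsingular (bilinearForm h) → ¬ γ ≈ 0# →
                  WeakSimilarityQ (diag g) (diag h) γ X Y → Adjoint g h X Y →
                  Bil.Similar (bilinearForm g) (bilinearForm h)
  weak⇒similarB {n} {γ} {g} {h} X Y g-sym h-sym g-nonsing h-nonsing γ≉0 weak adj =
    let T , U , w , UT≋id = weakIsometry⇒isometry (B-symmetricBilinear {g = g} g-sym)
          (scaledSymmetricBilinear scaling {h} h-sym) g-nonsing
          (λ x p → h-nonsing x λ y → cancelˡ scaling≉0 (p y)) weakIsometry
        open IsWeakIsometry w
        inj : Injective T-linear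
        inj {x} Tx≋0 = ≋-trans (≋-sym (UT≋id x)) (IsLinear.0-homo U-linear Tx≋0)
    in scaling , ≉⇒# scaling≉0 , T ,
      isomorphism T-linear (λ {x} → inj {x}) (injective⇒surjective T-linear λ {x} → inj {x}) , λ x y → begin
        B (λ i j → scaling * h i j) (T x) (T y) ≈⟨ B-scale scaling h (T x) (T y) ⟩
        scaling * B h (T x) (T y)               ≈⟨ adjoint x (T y) ⟩
        B g x (U (T y))                         ≈⟨ B-cong {g = g} ≋-refl (UT≋id y) ⟩
        B g x y                                 ∎
    where
    open Rescaled {γ = γ} (diag g) (diag h) X Y γ≉0 weak

    diagonal : ∀ {g : Matrix n n} → Symmetric g → ∀ x → B g x x ≈ Q (diag g) x
    diagonal {g} g-sym = B-diagonal {g = g} (symmetric⇒alternating {g = g} g-sym)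

    XY-adjoint : ∀ x y → B h (comb x X) y ≈ B g x (comb y Y)
    XY-adjoint x y = begin
      B h (comb x X) y                ≈⟨ B-cong {g = h} ≋-refl (comb-δ y) ⟨
      B h (comb x X) (comb y δ)       ≈⟨ B-comb h x X y δ ⟩
      B (λ k l → B h (X k) (δ l)) x y ≈⟨ sum-cong (λ k → sum-cong λ l → *-congʳ
                                           (trans (B-δʳ h (X k) l) (trans (adj k l) (sym (B-δˡ g k (Y l)))))) ⟩
      B (λ k l → B g (δ k) (Y l)) x y ≈⟨ B-comb g x δ y Y ⟨
      B g (comb x δ) (comb y Y)       ≈⟨ B-cong {g = g} (comb-δ x) ≋-refl ⟩
      B g x (comb y Y)                ∎

    weakIsometry : IsWeakIsometry (B g) (λ x y → scaling * B h x y) (λ x → comb x X) (λ y → scaling *ᵥ comb y Y)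
    weakIsometry = record
      { T-linear = comb-linear X
      ; U-linear = Y-linear
      ; adjoint  = λ x y → trans (*-congˡ (XY-adjoint x y)) (sym (B-*-homoʳ g scaling x (comb y Y)))
      ; T-quad   = λ x → trans (*-congˡ (diagonal {h} h-sym _)) (trans (X-quad x) (sym (diagonal {g} g-sym x)))
      ; U-quad   = λ y → trans (diagonal {g} g-sym _) (trans (Y-quad y) (*-congˡ (sym (diagonal {h} h-sym y))))
      }

-- The field `L` as a vector space over `F`.

module Extension (em : ∀ {ℓ} → ExcludedMiddle ℓ) {c ℓ₁ ℓ₂ c′ ℓ₁′ ℓ₂′}
                 {F : HeytingField c ℓ₁ ℓ₂} {L : HeytingField c′ ℓ₁′ ℓ₂′} (E : FieldExtension F L)
                 (char2 : HasCharacteristic2 F) where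

  open FieldExtension E public using (ι)
  open IsRingHomomorphism (FieldExtension.isRingHomomorphism E) public
    renaming (⟦⟧-cong to ι-cong; +-homo to ι-+; *-homo to ι-*; 1#-homo to ι-1; 0#-homo to ι-0)
    using ()

  extensionChar2 : HasCharacteristic2 L
  extensionChar2 = trans (+-cong (sym ι-1) (sym ι-1)) (trans (sym (ι-+ _ _)) (trans (ι-cong char2) ι-0))
    where open HeytingField L

  module 𝔽 = LinearAlgebra em F char2
  open LinearAlgebra em L extensionChar2 public

  ι-sum : ∀ {n} (x : 𝔽.Vec n) → ι (𝔽.sum x) ≈ sum (ι ∘ x)
  ι-sum {zero}  x = ι-0
  ι-sum {suc n} x = trans (ι-+ _ _) (+-congˡ (ι-sum (x ∘ suc)))

  ι-injective : ∀ {x} → ι x ≈ 0# → x 𝔽.≈ 𝔽.0#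
  ι-injective {x} ιx≈0 with em {P = x 𝔽.≈ 𝔽.0#}
  ... | yes x≈0 = x≈0
  ... | no  x≉0 with 𝔽.inverse x≉0
  ...   | y , yx≈1 = contradiction (begin
    1#         ≈⟨ ι-1 ⟨
    ι 𝔽.1#     ≈⟨ ι-cong yx≈1 ⟨
    ι (y 𝔽.* x) ≈⟨ ι-* y x ⟩
    ι y * ι x  ≈⟨ *-congˡ ιx≈0 ⟩
    ι y * 0#   ≈⟨ zeroʳ _ ⟩
    0#         ∎) 1≉0

  lin : ∀ {n} → 𝔽.Vec n → Vec n → Carrier
  lin x w = sum λ j → ι (x j) * w j

  _² : ∀ {n} → Vec n → Vec n
  (w ²) j = w j * w j

  lin-0 : ∀ {n} {x : 𝔽.Vec n} (w : Vec n) → x 𝔽.≋ 𝔽.0ᵥ → lin x w ≈ 0#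
  lin-0 w x≋0 = sum-zero _ λ j → trans (*-congʳ (trans (ι-cong (x≋0 j)) ι-0)) (zeroˡ _)

  lin-+ : ∀ {n} (x y : 𝔽.Vec n) (w : Vec n) → lin (x 𝔽.+ᵥ y) w ≈ lin x w + lin y w
  lin-+ x y w = trans (sum-cong λ j → trans (*-congʳ (ι-+ (x j) (y j))) (distribʳ (w j) _ _))
    (∑-distrib-+ (λ j → ι (x j) * w j) (λ j → ι (y j) * w j))

  lin-* : ∀ {n} a (x : 𝔽.Vec n) (w : Vec n) → lin (a 𝔽.*ᵥ x) w ≈ ι a * lin x w
  lin-* a x w = trans (sum-cong λ j → trans (*-congʳ (ι-* a (x j))) (*-assoc _ _ _))
    (sym (*-distribˡ-sum (ι a) (λ j → ι (x j) * w j)))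

  lin-comb : ∀ {m n} (x : 𝔽.Vec m) (v : Fin m → 𝔽.Vec n) (w : Vec n) →
             lin (𝔽.comb x v) w ≈ sum λ j → ι (x j) * lin (v j) w
  lin-comb {zero}  x v w = lin-0 w λ _ → 𝔽.refl
  lin-comb {suc m} x v w = trans (lin-+ (x zero 𝔽.*ᵥ v zero) (𝔽.comb (x ∘ suc) (v ∘ suc)) w)
    (+-cong (lin-* (x zero) (v zero) w) (lin-comb (x ∘ suc) (v ∘ suc) w))

  ι-δ : ∀ {n} (i j : Fin n) → ι (𝔽.δ i j) ≈ δ i j
  ι-δ zero    zero    = ι-1
  ι-δ zero    (suc j) = ι-0
  ι-δ (suc i) zero    = ι-0
  ι-δ (suc i) (suc j) = ι-δ i j

  lin-δ : ∀ {n} (w : Vec n) j → lin (𝔽.δ j) w ≈ w j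
  lin-δ w j = trans (sum-cong λ k → trans (*-comm _ _) (*-congˡ (trans (ι-δ j k) (δ-sym j k)))) (sum-δ w j)

  lin-*ˡ : ∀ {n} b (x : 𝔽.Vec n) (w : Vec n) → lin x (b *ᵥ w) ≈ b * lin x w
  lin-*ˡ b x w = trans (sum-cong λ j → solve 3 (λ x b w → x :* (b :* w) := b :* (x :* w)) refl (ι (x j)) b (w j))
    (sym (*-distribˡ-sum b (λ j → ι (x j) * w j)))

  -- Squaring is additive in characteristic 2, so squaring an element squares its coordinates while
  -- passing from `w` to `w ²`.
  lin-² : ∀ {n} (x : 𝔽.Vec n) (w : Vec n) → lin x w * lin x w ≈ lin (λ j → x j 𝔽.* x j) (w ²)
  lin-² {zero}  x w = zeroˡ 0#
  lin-² {suc n} x w = begin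
    (ι (x zero) * w zero + t) * (ι (x zero) * w zero + t)
      ≈⟨ solve 3 (λ x w t → (x :* w :+ t) :* (x :* w :+ t) := x :* x :* (w :* w) :+ t :* t) refl (ι (x zero)) (w zero) t ⟩
    ι (x zero) * ι (x zero) * (w zero * w zero) + t * t
      ≈⟨ +-cong (*-congʳ (sym (ι-* _ _))) (lin-² (x ∘ suc) (w ∘ suc)) ⟩
    ι (x zero 𝔽.* x zero) * (w zero * w zero) + lin (λ j → x (suc j) 𝔽.* x (suc j)) ((w ∘ suc) ²) ∎
    where t = lin (x ∘ suc) (w ∘ suc)

  InSpan : ∀ {n} → Vec n → Carrier → Set (c ⊔ ℓ₁′)
  InSpan w l = ∃[ x ] lin x w ≈ l

  module _ {n} {w : Vec n} where
    span-≈ : ∀ {l l′} → l ≈ l′ → InSpan w l → InSpan w l′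
    span-≈ l≈l′ (x , xw≈l) = x , trans xw≈l l≈l′

    span-gen : ∀ j → InSpan w (w j)
    span-gen j = 𝔽.δ j , lin-δ w j

    span-+ : ∀ {l l′} → InSpan w l → InSpan w l′ → InSpan w (l + l′)
    span-+ (x , xw≈l) (y , yw≈l′) = x 𝔽.+ᵥ y , trans (lin-+ x y w) (+-cong xw≈l yw≈l′)

    span-ι* : ∀ a {l} → InSpan w l → InSpan w (ι a * l)
    span-ι* a (x , xw≈l) = a 𝔽.*ᵥ x , trans (lin-* a x w) (*-congˡ xw≈l)

    span-0 : InSpan w 0#
    span-0 = 𝔽.0ᵥ , lin-0 w λ _ → 𝔽.refl

    span-² : ∀ {l} → InSpan w l → InSpan (w ²) (l * l)
    span-² (x , xw≈l) = (λ j → x j 𝔽.* x j) , trans (sym (lin-² x w)) (*-cong xw≈l xw≈l)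

    span-lin : ∀ {m} {v : Vec m} → (∀ j → InSpan w (v j)) → ∀ x → InSpan w (lin x v)
    span-lin v⊆w x = 𝔽.comb x (proj₁ ∘ v⊆w) , trans (lin-comb x (proj₁ ∘ v⊆w) w) (sum-cong λ j → *-congˡ (proj₂ (v⊆w j)))

    span-trans : ∀ {m} {v : Vec m} → (∀ j → InSpan w (v j)) → ∀ {l} → InSpan v l → InSpan w l
    span-trans v⊆w (x , xv≈l) = span-≈ xv≈l (span-lin v⊆w x)

  span-*ˡ : ∀ {m n} {v : Vec m} {w : Vec n} b → (∀ j → InSpan w (b * v j)) → ∀ {l} → InSpan v l → InSpan w (b * l)
  span-*ˡ {v = v} b bv⊆w (x , xv≈l) = span-≈ (trans (lin-*ˡ b x v) (*-congˡ xv≈l)) (span-lin bv⊆w x)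

  -- Independence over `F` and families spanned by their squares.

  FIndependent : ∀ {n} → Vec n → Set (c ⊔ ℓ₁ ⊔ ℓ₁′)
  FIndependent w = ∀ x → lin x w ≈ 0# → x 𝔽.≋ 𝔽.0ᵥ

  fIndependent-∷ : ∀ {n} {w : Vec n} {l} → FIndependent w → ¬ InSpan w l → FIndependent (l ∷ᵥ w)
  fIndependent-∷ {w = w} {l} indep l∉w x xlw≈0 with em {P = x zero 𝔽.≈ 𝔽.0#}
  ... | yes x₀≈0 = λ { zero → x₀≈0 ; (suc j) → indep (x ∘ suc) tail≈0 j }
    where
    tail≈0 : lin (x ∘ suc) w ≈ 0#
    tail≈0 = trans (sym (trans (+-congʳ (trans (*-congʳ (trans (ι-cong x₀≈0) ι-0)) (zeroˡ l))) (+-identityˡ _))) xlw≈0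
  ... | no x₀≉0 with 𝔽.inverse x₀≉0
  ...   | a , ax₀≈1 = contradiction (span-≈ (begin
    ι a * lin (x ∘ suc) w   ≈⟨ *-congˡ (x+y≈0⇒x≈y xlw≈0) ⟨
    ι a * (ι (x zero) * l)  ≈⟨ *-assoc _ _ l ⟨
    ι a * ι (x zero) * l    ≈⟨ *-congʳ (trans (sym (ι-* a _)) (trans (ι-cong ax₀≈1) ι-1)) ⟩
    1# * l                  ≈⟨ *-identityˡ l ⟩
    l                       ∎) (span-ι* a (x ∘ suc , refl))) l∉w

  -- If `l` were outside the span of `v`, adjoining it would keep `v` independent; but `suc n`
  -- coordinate vectors with respect to `w` are dependent.
  independent⇒spanning : ∀ {n} {v w : Vec n} → FIndependent v → (∀ i → InSpan w (v i)) →
                         ∀ {l} → InSpan w l → InSpan v l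
  independent⇒spanning {n} {v} {w} indep v⊆w {l} l∈w with em {P = InSpan v l}
  ... | yes l∈v = l∈v
  ... | no  l∉v with 𝔽.dependent (ℕ.n<1+n n) (proj₁ l∈w ∷ᵥ (proj₁ ∘ v⊆w))
  ...   | t , t≉0 , t-dep = contradiction (fIndependent-∷ {w = v} indep l∉v t (begin
    ι (t zero) * l + lin (t ∘ suc) v
      ≈⟨ +-cong (*-congˡ (proj₂ l∈w)) (sum-cong λ j → *-congˡ (proj₂ (v⊆w j))) ⟨
    ι (t zero) * lin (proj₁ l∈w) w + sum (λ j → ι (t (suc j)) * lin (proj₁ (v⊆w j)) w)
      ≈⟨ lin-comb t (proj₁ l∈w ∷ᵥ (proj₁ ∘ v⊆w)) w ⟨
    lin (𝔽.comb t (proj₁ l∈w ∷ᵥ (proj₁ ∘ v⊆w))) w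
      ≈⟨ lin-0 w t-dep ⟩
    0# ∎)) t≉0

  -- The relation `x` and the coordinates of `w` are `suc n` vectors of length `n`, hence dependent.
  -- Evaluated on `v`, where `x` gives 0, the dependence becomes a relation of `w`; so only the
  -- coefficient of `x` is nonzero, and `x` is zero.
  spanning⇒independent : ∀ {n} {v w : Vec n} → FIndependent w → (∀ i → InSpan v (w i)) → FIndependent v
  spanning⇒independent {n} {v} {w} indep w⊆v x xv≈0 with 𝔽.dependent (ℕ.n<1+n n) (x ∷ᵥ (proj₁ ∘ w⊆v))
  ... | t , t≉0 , t-dep = λ j → 𝔽.cancelˡ t₀≉0 (t₀x≈0 j)
    where
    tail≋0 : t ∘ suc 𝔽.≋ 𝔽.0ᵥ
    tail≋0 = indep (t ∘ suc) (begin
      lin (t ∘ suc) w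
        ≈⟨ sum-cong (λ j → *-congˡ (proj₂ (w⊆v j))) ⟨
      sum (λ j → ι (t (suc j)) * lin (proj₁ (w⊆v j)) v)
        ≈⟨ trans (+-congʳ (trans (*-congˡ xv≈0) (zeroʳ _))) (+-identityˡ _) ⟨
      ι (t zero) * lin x v + sum (λ j → ι (t (suc j)) * lin (proj₁ (w⊆v j)) v)
        ≈⟨ lin-comb t (x ∷ᵥ (proj₁ ∘ w⊆v)) v ⟨
      lin (𝔽.comb t (x ∷ᵥ (proj₁ ∘ w⊆v))) v
        ≈⟨ lin-0 v t-dep ⟩
      0# ∎)

    t₀≉0 : ¬ t zero 𝔽.≈ 𝔽.0#
    t₀≉0 t₀≈0 = t≉0 λ { zero → t₀≈0 ; (suc j) → tail≋0 j }

    t₀x≈0 : ∀ j → t zero 𝔽.* x j 𝔽.≈ 𝔽.0#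
    t₀x≈0 j = 𝔽.trans
      (𝔽.sym (𝔽.trans (𝔽.+-congˡ (𝔽.sum-zero _ λ i → 𝔽.trans (𝔽.*-congʳ (tail≋0 i)) (𝔽.zeroˡ _))) (𝔽.+-identityʳ _)))
      (t-dep j)

  -- Elements of `g` are adjoined one by one, whenever they lie outside the span reached so far. The
  -- last component records the origin of each element, so that properties of `w` and `g` carry
  -- over.
  extendIndependent : ∀ {d n} (g : Vec d) (w : Vec n) → FIndependent w →
    ∃[ n′ ] ∃ λ (w′ : Vec n′) → FIndependent w′ × (∀ i → InSpan w′ (w i)) × (∀ j → InSpan w′ (g j)) ×
      (∀ k → (∃[ i ] w′ k ≡ w i) ⊎ (∃[ j ] w′ k ≡ g j))
  extendIndependent {zero}  g w indep = _ , w , indep , span-gen , (λ ()) , λ k → inj₁ (k , ≡.refl)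
  extendIndependent {suc d} g w indep with extendIndependent (g ∘ suc) w indep
  ... | n′ , w′ , indep′ , w⊆w′ , g⊆w′ , origin with em {P = InSpan w′ (g zero)}
  ...   | yes g₀∈w′ = n′ , w′ , indep′ , w⊆w′ ,
    (λ { zero → g₀∈w′ ; (suc j) → g⊆w′ j }) , λ k → Sum.map₂ (λ (j , p) → suc j , p) (origin k)
  ...   | no  g₀∉w′ = suc n′ , (g zero ∷ᵥ w′) , fIndependent-∷ indep′ g₀∉w′ , (λ i → weaken (w⊆w′ i)) ,
    (λ { zero → span-gen {w = g zero ∷ᵥ w′} zero ; (suc j) → weaken (g⊆w′ j) }) ,
    λ { zero → inj₂ (zero , ≡.refl) ; (suc k) → Sum.map₂ (λ (j , p) → suc j , p) (origin k) }
    where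
    weaken : ∀ {l} → InSpan w′ l → InSpan (g zero ∷ᵥ w′) l
    weaken = span-trans {w = g zero ∷ᵥ w′} {v = w′} λ k → span-gen {w = g zero ∷ᵥ w′} (suc k)

  -- By `spanning⇒independent` the squares are then independent too. Containment in the span of the
  -- squares is the formulation that `mergeGood` propagates.
  Good : ∀ {n} → Vec n → Set (c ⊔ ℓ₁ ⊔ ℓ₁′)
  Good w = FIndependent w × ∀ i → InSpan (w ²) (w i)

  -- Each element of `w′` comes from `w` or `g`, so it lies in the span of the squares of that
  -- family, which is inside the span of `w′ ²`.
  mergeGood : ∀ {d n} (g : Vec d) (w : Vec n) → Good g → Good w →
    ∃[ n′ ] ∃ λ (w′ : Vec n′) → Good w′ × (∀ i → InSpan w′ (w i)) × (∀ j → InSpan w′ (g j))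
  mergeGood g w (_ , g⊆g²) (indep , w⊆w²) with extendIndependent g w indep
  ... | n′ , w′ , indep′ , w⊆w′ , g⊆w′ , origin = n′ , w′ , (indep′ , w′⊆w′²) , w⊆w′ , g⊆w′
    where
    w′⊆w′² : ∀ k → InSpan (w′ ²) (w′ k)
    w′⊆w′² k with origin k
    ... | inj₁ (i , p) = ≡.subst (InSpan (w′ ²)) (≡.sym p) (span-trans (span-² ∘ w⊆w′) (w⊆w² i))
    ... | inj₂ (j , p) = ≡.subst (InSpan (w′ ²)) (≡.sym p) (span-trans (span-² ∘ g⊆w′) (g⊆g² j))

-- Separable elements and the squares of their powers.

module SeparableElement (em : ∀ {ℓ} → ExcludedMiddle ℓ) {c ℓ₁ ℓ₂ c′ ℓ₁′ ℓ₂′}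
                        {F : HeytingField c ℓ₁ ℓ₂} {L : HeytingField c′ ℓ₁′ ℓ₂′} (E : FieldExtension F L)
                        (char2 : HasCharacteristic2 F) (α : HeytingField.Carrier L) where

  open Extension em E char2
  open Polynomials F

  eval : Poly → Carrier
  eval = evalAt E α

  eval-[]-cong : ∀ p → (∀ k → coeff p k 𝔽.≈ 𝔽.0#) → eval p ≈ 0#
  eval-[]-cong []      p≈0 = refl
  eval-[]-cong (a ∷ p) p≈0 = trans (+-cong (trans (ι-cong (p≈0 0)) ι-0)
    (trans (*-congˡ (eval-[]-cong p (p≈0 ∘ suc))) (zeroʳ α))) (+-identityˡ 0#)

  eval-cong : ∀ p q → p ≈ₚ q → eval p ≈ eval q
  eval-cong []      q       p≈q = sym (eval-[]-cong q λ k → 𝔽.sym (p≈q k))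
  eval-cong (a ∷ p) []      p≈q = eval-[]-cong (a ∷ p) p≈q
  eval-cong (a ∷ p) (b ∷ q) p≈q = +-cong (ι-cong (p≈q 0)) (*-congˡ (eval-cong p q (p≈q ∘ suc)))

  eval-+ : ∀ p q → eval (p +ₚ q) ≈ eval p + eval q
  eval-+ []      q       = sym (+-identityˡ _)
  eval-+ (a ∷ p) []      = sym (+-identityʳ _)
  eval-+ (a ∷ p) (b ∷ q) = trans (+-cong (ι-+ a b) (*-congˡ (eval-+ p q)))
    (solve 5 (λ a b α p q → a :+ b :+ α :* (p :+ q) := a :+ α :* p :+ (b :+ α :* q)) refl (ι a) (ι b) α (eval p) (eval q))

  eval-map : ∀ a q → eval (map (a 𝔽.*_) q) ≈ ι a * eval q
  eval-map a []      = sym (zeroʳ _)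
  eval-map a (b ∷ q) = trans (+-cong (ι-* a b) (*-congˡ (eval-map a q)))
    (solve 4 (λ a b α q → a :* b :+ α :* (a :* q) := a :* (b :+ α :* q)) refl (ι a) (ι b) α (eval q))

  eval-* : ∀ p q → eval (p *ₚ q) ≈ eval p * eval q
  eval-* []      q = sym (zeroˡ _)
  eval-* (a ∷ p) q = trans (eval-+ (map (a 𝔽.*_) q) (𝔽.0# ∷ (p *ₚ q)))
    (trans (+-cong (eval-map a q) (+-cong ι-0 (*-congˡ (eval-* p q))))
      (solve 4 (λ a α p q → a :* q :+ (con false :+ α :* (p :* q)) := (a :+ α :* p) :* q) refl (ι a) α (eval p) (eval q)))

  -- p = even p (X²) + X · odd p (X²), both parts evaluated at α².
  even odd : Poly → Carrier
  even []      = 0#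
  even (a ∷ p) = ι a + α * α * odd p
  odd []       = 0#
  odd (a ∷ p)  = even p

  eval-even-odd : ∀ p → eval p ≈ even p + α * odd p
  eval-even-odd []      = solve 1 (λ α → con false := con false :+ α :* con false) refl α
  eval-even-odd (a ∷ p) = trans (+-congˡ (*-congˡ (eval-even-odd p)))
    (solve 4 (λ a α e o → a :+ α :* (e :+ α :* o) := a :+ α :* α :* o :+ α :* e) refl (ι a) α (even p) (odd p))

  -- The local function of derivative is not in scope; unification recovers it.
  mutual
    derivativeFrom : 𝔽.Carrier → Poly → ℕ → Poly → Poly
    derivativeFrom = _

    derivativeFrom-spec : ∀ a b p → ∃[ b′ ] derivative (a ∷ b ∷ p) ≡ b′ ∷ derivativeFrom a (b ∷ p) 2 p
    derivativeFrom-spec a b p with b ∷ p | 2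
    ... | q | k = _ , ≡.refl

  -- In characteristic 2, a multiple `k · b` is `b` for odd `k` and 0 for even `k`, so exactly the
  -- odd powers contribute.
  eval-derivative : ∀ p → eval (derivative p) ≈ odd p
  eval-derivative []      = refl
  eval-derivative (a ∷ p) = fromOdd 1 (λ b → 𝔽.+-identityʳ b) p
    where
    open import Algebra.Definitions.RawMonoid 𝔽.+-rawMonoid using () renaming (_×_ to _·_)

    fromOdd  : ∀ k → (∀ b → k · b 𝔽.≈ b) → ∀ q → eval (derivativeFrom a p k q) ≈ even q
    fromEven : ∀ k → (∀ b → k · b 𝔽.≈ 𝔽.0#) → ∀ q → eval (derivativeFrom a p k q) ≈ α * odd q

    fromOdd k k-odd []      = refl
    fromOdd k k-odd (b ∷ q) = trans
      (+-cong (ι-cong (k-odd b)) (*-congˡ (fromEven (suc k) (λ b → 𝔽.trans (𝔽.+-congˡ (k-odd b)) (𝔽.x+x≈0 b)) q)))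
      (+-congˡ (sym (*-assoc α α _)))

    fromEven k k-even []      = sym (zeroʳ α)
    fromEven k k-even (b ∷ q) = trans
      (+-cong (trans (ι-cong (k-even b)) ι-0) (*-congˡ (fromOdd (suc k) (λ b → 𝔽.trans (𝔽.+-congˡ (k-even b)) (𝔽.+-identityʳ b)) q)))
      (+-identityˡ _)

  power : ℕ → Carrier
  power zero    = 1#
  power (suc k) = α * power k

  powers : ∀ d → Vec d
  powers d j = power (toℕ j)

  power∈powers : ∀ {k d} → k < d → InSpan (powers d) (power k)
  power∈powers k<d = span-≈ (reflexive (≡.cong power (Fin.toℕ-fromℕ< k<d))) (span-gen (fromℕ< k<d))

  -- `l` collects the terms of degree below `d`, and list entries beyond `d` are trailing zeros. At
  -- a root, `power d` therefore falls into the span of the lower powers.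
  eval-monic : ∀ d p → coeff p d 𝔽.≈ 𝔽.1# → (∀ k → d < k → coeff p k 𝔽.≈ 𝔽.0#) →
               ∃[ l ] InSpan (powers d) l × eval p ≈ l + power d
  eval-monic d       []      p_d≈1 _ = contradiction (𝔽.sym p_d≈1) 𝔽.1≉0
  eval-monic zero    (a ∷ p) a≈1   above = 0# , span-0 {w = powers 0} , (begin
    ι a + α * eval p ≈⟨ +-cong (trans (ι-cong a≈1) ι-1) (*-congˡ (eval-[]-cong p λ k → above (suc k) (s≤s z≤n))) ⟩
    1# + α * 0#      ≈⟨ solve 1 (λ α → con true :+ α :* con false := con false :+ con true) refl α ⟩
    0# + 1#          ∎)
  eval-monic (suc d) (a ∷ p) p_d≈1 above with eval-monic d p p_d≈1 (λ k d<k → above (suc k) (s≤s d<k))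
  ... | l , (x , x-pow≈l) , eval≈ = ι a + α * l ,
    (a ∷ᵥ x , +-cong (*-identityʳ (ι a)) (trans (lin-*ˡ α x (powers d)) (*-congˡ x-pow≈l))) ,
    trans (+-congˡ (*-congˡ eval≈)) (solve 4 (λ a α l q → a :+ α :* (l :+ q) := a :+ α :* l :+ α :* q) refl (ι a) α l (power d))

  module _ (p : Poly) (p-minimal : IsMinimalPolynomial E α p) (p-separable : SeparablePoly p) where
    open IsMinimalPolynomial p-minimal

    -- Otherwise `α` is a root of the derivative, so `p` divides both itself and its derivative. By
    -- separability it divides 1, which is impossible as `p` vanishes at `α`.
    odd≉0 : ¬ odd p ≈ 0#
    odd≉0 odd≈0 with p-separable (minimal p root) (minimal (derivative p) (trans (eval-derivative p) odd≈0))
    ... | RawMagma._,_ q qp≈1 = 1≉0 (begin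
      1#                      ≈⟨ ι-1 ⟨
      ι 𝔽.1#                  ≈⟨ trans (+-congˡ (zeroʳ α)) (+-identityʳ _) ⟨
      eval (𝔽.1# ∷ [])        ≈⟨ eval-cong (q *ₚ p) (𝔽.1# ∷ []) qp≈1 ⟨
      eval (q *ₚ p)           ≈⟨ eval-* q p ⟩
      eval q * eval p         ≈⟨ *-congˡ root ⟩
      eval q * 0#             ≈⟨ zeroʳ _ ⟩
      0#                      ∎)

    -- Together with `odd≉0` this exhibits `α` as a quotient of two polynomials in `α * α`.
    even≈α*odd : even p ≈ α * odd p
    even≈α*odd = x+y≈0⇒x≈y (trans (sym (eval-even-odd p)) root)

    degree : ℕ
    degree = proj₁ monic

    pows : Vec degree
    pows = powers degree

    power-degree : InSpan pows (power degree)
    power-degree = let l , l∈ , eval≈ = eval-monic degree p (proj₁ (proj₂ monic)) (proj₂ (proj₂ monic)) in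
      span-≈ (x+y≈0⇒x≈y (trans (sym eval≈) root)) l∈

    power∈pows-≤ : ∀ {k} → k ≤ degree → InSpan pows (power k)
    power∈pows-≤ {k} k≤d with ℕ.m≤n⇒m<n∨m≡n k≤d
    ... | inj₁ k<d    = power∈powers k<d
    ... | inj₂ ≡.refl = power-degree

    α*-closed : ∀ {l} → InSpan pows l → InSpan pows (α * l)
    α*-closed = span-*ˡ {v = pows} α λ j → power∈pows-≤ (Fin.toℕ<n j)

    power∈pows : ∀ k → InSpan pows (power k)
    power∈pows zero    = power∈pows-≤ z≤n
    power∈pows (suc k) = α*-closed (power∈pows k)

    power*-closed : ∀ k {l} → InSpan pows l → InSpan pows (power k * l)
    power*-closed zero    l∈ = span-≈ (sym (*-identityˡ _)) l∈
    power*-closed (suc k) l∈ = span-≈ (sym (*-assoc α _ _)) (α*-closed (power*-closed k l∈))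

    squares⊆pows : ∀ {l} → InSpan (pows ²) l → InSpan pows l
    squares⊆pows = span-trans {v = pows ²} λ j → power*-closed (toℕ j) (span-gen {w = pows} j)

    α²*-closed : ∀ {l} → InSpan (pows ²) l → InSpan (pows ²) (α * α * l)
    α²*-closed = span-*ˡ {v = pows ²} (α * α) λ j → span-≈
      (solve 2 (λ α x → α :* x :* (α :* x) := α :* α :* (x :* x)) refl α (power (toℕ j)))
      (span-² {w = pows} (power∈pows (suc (toℕ j))))

    even*-closed : ∀ q {l} → InSpan (pows ²) l → InSpan (pows ²) (even q * l)
    odd*-closed  : ∀ q {l} → InSpan (pows ²) l → InSpan (pows ²) (odd q * l)
    even*-closed []      l∈ = span-≈ (sym (zeroˡ _)) (span-0 {w = pows ²})
    even*-closed (a ∷ q) {l} l∈ = span-≈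
      (solve 4 (λ a α o l → a :* l :+ α :* α :* (o :* l) := (a :+ α :* α :* o) :* l) refl (ι a) α (odd q) l)
      (span-+ {w = pows ²} (span-ι* {w = pows ²} a l∈) (α²*-closed (odd*-closed q l∈)))
    odd*-closed  []      l∈ = span-≈ (sym (zeroˡ _)) (span-0 {w = pows ²})
    odd*-closed  (a ∷ q) l∈ = even*-closed q l∈

    1∈squares : InSpan (pows ²) 1#
    1∈squares = span-≈ (*-identityˡ 1#) (span-² {w = pows} (power∈pows 0))

    -- The span of the squares is stable under `α * α`, so the exponent goes up in steps of two.
    -- Exponent 1 is started by trading `odd p * α` for `even p`.
    odd*power∈squares : ∀ k → InSpan (pows ²) (odd p * power k)
    odd*power∈squares zero          = odd*-closed p 1∈squares
    odd*power∈squares (suc zero)    = span-≈ (trans (*-congʳ even≈α*odd)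
      (solve 2 (λ α o → α :* o :* con true := o :* (α :* con true)) refl α (odd p))) (even*-closed p 1∈squares)
    odd*power∈squares (suc (suc k)) = span-≈
      (solve 3 (λ α o x → α :* α :* (o :* x) := o :* (α :* (α :* x))) refl α (odd p) (power k))
      (α²*-closed (odd*power∈squares k))

    -- Multiplication by odd p maps the finite-dimensional space F[α] injectively into the span of
    -- its squares, so the squares span F[α].
    goodContaining : ∃[ n ] ∃ λ (w : Vec n) → Good w × InSpan w α
    -- Extending the empty family by the powers extracts from them an independent family with the
    -- same span.
    goodContaining with extendIndependent {n = 0} pows (λ ()) (λ _ _ ())
    ... | n , w , indep , _ , pows⊆w , origin = n , w , (indep , w⊆w²) ,
      span-≈ (*-identityʳ α) (span-trans {w = w} {v = pows} pows⊆w (power∈pows 1))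
      where
      isPower : ∀ k → ∃[ j ] w k ≡ pows j
      isPower k with origin k
      ... | inj₂ q = q

      odd*w∈squares : ∀ k → InSpan (pows ²) (odd p * w k)
      odd*w∈squares k = let j , wₖ≡ = isPower k in
        span-≈ {w = pows ²} (*-congˡ (reflexive (≡.sym wₖ≡))) (odd*power∈squares (toℕ j))

      odd*w-independent : FIndependent (odd p *ᵥ w)
      odd*w-independent x x-odd*w≈0 = indep x (cancelˡ odd≉0 (trans (sym (lin-*ˡ (odd p) x w)) x-odd*w≈0))

      w⊆w² : ∀ k → InSpan (w ²) (w k)
      w⊆w² k = span-trans {w = w ²} {v = odd p *ᵥ w}
        (λ i → span-trans {w = w ²} {v = pows ²} (λ j → span-² {w = w} (pows⊆w j)) (odd*w∈squares i))
        -- The multiples of `w` by `odd p` are independent, as many as `w` and inside its span,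
        -- hence they span it.
        (independent⇒spanning {v = odd p *ᵥ w} {w} odd*w-independent
          (λ i → span-trans {w = w} {v = pows} pows⊆w (squares⊆pows (odd*w∈squares i)))
          (span-gen {w = w} k))

-- Descent of weak similarities from `L` to `F`.

module Descent (em : ∀ {ℓ} → ExcludedMiddle ℓ) {c ℓ₁ ℓ₂ c′ ℓ₁′ ℓ₂′}
               {F : HeytingField c ℓ₁ ℓ₂} {L : HeytingField c′ ℓ₁′ ℓ₂′} (E : FieldExtension F L)
               (char2 : HasCharacteristic2 F) (separable : IsSeparableAlgebraic E) where

  open Extension em E char2
  module FormsF = Forms em F char2
  module FormsL = Forms em L extensionChar2
  module SimF = Similarities em F char2
  module SimL = Similarities em L extensionChar2

  GoodExtension : ∀ {n} → Vec n → (∀ {n′} → Vec n′ → Set (c ⊔ ℓ₁′)) → Set (c ⊔ ℓ₁ ⊔ c′ ⊔ ℓ₁′)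
  GoodExtension {n} w P = ∃[ n′ ] ∃ λ (w′ : Vec n′) → Good w′ × (∀ i → InSpan w′ (w i)) × P w′

  adjoin : ∀ {n} (w : Vec n) → Good w → ∀ α → GoodExtension w (λ w′ → InSpan w′ α)
  adjoin w w-good α =
    let p , p-minimal , p-separable = separable α
        d , g , g-good , α∈g = SeparableElement.goodContaining em E char2 α p p-minimal p-separable
        n′ , w′ , w′-good , w⊆w′ , g⊆w′ = mergeGood g w g-good w-good
    in n′ , w′ , w′-good , w⊆w′ , span-trans {w = w′} {v = g} g⊆w′ α∈g

  adjoinVec : ∀ {m n} (w : Vec n) → Good w → (t : Vec m) → GoodExtension w (λ w′ → ∀ i → InSpan w′ (t i))
  adjoinVec {zero}  w w-good t = _ , w , w-good , span-gen {w = w} , λ ()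
  adjoinVec {suc m} w w-good t =
    let n₁ , w₁ , w₁-good , w⊆w₁ , t⊆w₁ = adjoinVec w w-good (t ∘ suc)
        n₂ , w₂ , w₂-good , w₁⊆w₂ , t₀∈w₂ = adjoin w₁ w₁-good (t zero)
    in n₂ , w₂ , w₂-good , (λ i → span-trans {w = w₂} {v = w₁} w₁⊆w₂ (w⊆w₁ i)) ,
       λ { zero → t₀∈w₂ ; (suc i) → span-trans {w = w₂} {v = w₁} w₁⊆w₂ (t⊆w₁ i) }

  adjoinMatrix : ∀ {l m n} (w : Vec n) → Good w → (t : Fin l → Vec m) →
                 GoodExtension w (λ w′ → ∀ i j → InSpan w′ (t i j))
  adjoinMatrix {zero}  w w-good t = _ , w , w-good , span-gen {w = w} , λ ()
  adjoinMatrix {suc l} w w-good t =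
    let n₁ , w₁ , w₁-good , w⊆w₁ , t⊆w₁ = adjoinMatrix w w-good (t ∘ suc)
        n₂ , w₂ , w₂-good , w₁⊆w₂ , t₀∈w₂ = adjoinVec w₁ w₁-good (t zero)
    in n₂ , w₂ , w₂-good , (λ i → span-trans {w = w₂} {v = w₁} w₁⊆w₂ (w⊆w₁ i)) ,
       λ { zero → t₀∈w₂ ; (suc i) j → span-trans {w = w₂} {v = w₁} w₁⊆w₂ (t⊆w₁ i j) }

  lin-injective : ∀ {n} {w : Vec n} → FIndependent w → ∀ x y → lin x w ≈ lin y w → x 𝔽.≋ y
  lin-injective {w = w} indep x y xw≈yw i = 𝔽.x+y≈0⇒x≈y
    (indep (x 𝔽.+ᵥ y) (trans (lin-+ x y w) (trans (+-congʳ xw≈yw) (x+x≈0 _))) i)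

  ιᵐ : ∀ {m n} → FormsF.Matrix m n → FormsL.Matrix m n
  ιᵐ g i j = ι (g i j)

  -- `γ`, `X′` and `Y′` are fixed before the forms are given, so one choice of coordinate serves the
  -- quadratic and the adjointness conditions together.
  Descended : ∀ {m n} → Carrier → FormsL.Matrix m n → FormsL.Matrix n m → Set (c ⊔ ℓ₁ ⊔ ℓ₁′)
  Descended {m} {n} e X Y = ∃[ γ ] ¬ γ 𝔽.≈ 𝔽.0# × (∃[ X′ ] ∃[ Y′ ]
    (∀ d d′ → SimL.WeakSimilarityQ (ι ∘ d) (ι ∘ d′) e X Y → SimF.WeakSimilarityQ {m} {n} d d′ γ X′ Y′) ×
    (∀ g h → SimL.Adjoint (ιᵐ g) (ιᵐ h) X Y → SimF.Adjoint {m} {n} g h X′ Y′))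

  -- The entries of X and Y and the scalar e lie in the span of a family w of elements of L such
  -- that w and w² are both linearly independent over F.  Then X ↦ X′ is the k-th coordinate with
  -- respect to w and e ↦ γ the k-th coordinate with respect to w², for a k with γ ≉ 0.
  descend : ∀ {m n e} (X : FormsL.Matrix m n) (Y : FormsL.Matrix n m) → ¬ e ≈ 0# → Descended e X Y
  descend {m} {n} {e} X Y e≉0 =
    let _ , w₁ , w₁-good , _ , e∈w₁           = adjoin {0} (λ ()) ((λ _ _ ()) , λ ()) e
        _ , w₂ , w₂-good , w₁⊆w₂ , X⊆w₂       = adjoinMatrix w₁ w₁-good X
        _ , w , (indep , w⊆w²) , w₂⊆w , Y⊆w   = adjoinMatrix w₂ w₂-good Y
        e∈w = span-trans {w = w} {v = w₂} w₂⊆w (span-trans {w = w₂} {v = w₁} w₁⊆w₂ e∈w₁)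
        X⊆w = λ i j → span-trans {w = w} {v = w₂} w₂⊆w (X⊆w₂ i j)
    -- `w` lies in the span of its equally many squares, which puts `e` there and makes the squares
    -- independent.
    in coordinates w indep (spanning⇒independent {v = w ²} {w} indep w⊆w²)
         (span-trans {w = w ²} {v = w} w⊆w² e∈w) X⊆w Y⊆w
    where
    coordinates : ∀ {N} (w : Vec N) → FIndependent w → FIndependent (w ²) → InSpan (w ²) e →
      (∀ i j → InSpan w (X i j)) → (∀ i j → InSpan w (Y i j)) → Descended e X Y
    coordinates {N} w indep indep² (γ , γw²≈e) X⊆w Y⊆w
      with 𝔽.≉⇒∃≉0 {x = γ} (λ γ≋0 → e≉0 (trans (sym γw²≈e) (lin-0 (w ²) γ≋0)))
    ... | k , γₖ≉0 = γ k , γₖ≉0 , (λ i j → proj₁ (X⊆w i j) k) , (λ i j → proj₁ (Y⊆w i j) k) ,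
      (λ d d′ (X-quad , Y-quad) → (λ i → quadratic (X i) (X⊆w i) d′ (d i) (X-quad i))
                                , (λ i → quadratic (Y i) (Y⊆w i) d (d′ i) (Y-quad i))) ,
      λ g h adj i j → linear (X i) (X⊆w i) (Y j) (Y⊆w j) (λ l → h l j) (g i) (adj i j)
      where
      -- As squaring is additive, both sides of the hypothesis expand in `w ²` over `F`; their
      -- `k`-th coefficients are compared.
      quadratic : ∀ {l} (x : Vec l) (x⊆w : ∀ j → InSpan w (x j)) (d : 𝔽.Vec l) a →
                  FormsL.Q (ι ∘ d) x ≈ e * ι a → FormsF.Q d (λ j → proj₁ (x⊆w j) k) 𝔽.≈ γ k 𝔽.* a
      quadratic x x⊆w d a Qx≈ea = 𝔽.trans
        (lin-injective {w = w ²} indep² (𝔽.comb d λ j i → proj₁ (x⊆w j) i 𝔽.* proj₁ (x⊆w j) i) (a 𝔽.*ᵥ γ) (begin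
          lin (𝔽.comb d λ j i → proj₁ (x⊆w j) i 𝔽.* proj₁ (x⊆w j) i) (w ²)
            ≈⟨ lin-comb d (λ j i → proj₁ (x⊆w j) i 𝔽.* proj₁ (x⊆w j) i) (w ²) ⟩
          sum (λ j → ι (d j) * lin (λ i → proj₁ (x⊆w j) i 𝔽.* proj₁ (x⊆w j) i) (w ²))
            ≈⟨ sum-cong (λ j → *-congˡ (proj₂ (span-² {w = w} (x⊆w j)))) ⟩
          FormsL.Q (ι ∘ d) x
            ≈⟨ Qx≈ea ⟩
          e * ι a
            ≈⟨ *-comm e (ι a) ⟩
          ι a * e
            ≈⟨ *-congˡ γw²≈e ⟨
          ι a * lin γ (w ²)
            ≈⟨ lin-* a γ (w ²) ⟨
          lin (a 𝔽.*ᵥ γ) (w ²) ∎) k)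
        (𝔽.*-comm a (γ k))

      -- The same comparison with respect to `w`, the condition being linear in the entries.
      linear : ∀ {p q} (x : Vec p) (x⊆w : ∀ j → InSpan w (x j)) (y : Vec q) (y⊆w : ∀ j → InSpan w (y j))
               (a : 𝔽.Vec p) (b : 𝔽.Vec q) → sum (λ i → ι (a i) * x i) ≈ sum (λ j → ι (b j) * y j) →
               𝔽.sum (λ i → a i 𝔽.* proj₁ (x⊆w i) k) 𝔽.≈ 𝔽.sum (λ j → b j 𝔽.* proj₁ (y⊆w j) k)
      linear x x⊆w y y⊆w a b ax≈by = lin-injective {w = w} indep (𝔽.comb a (proj₁ ∘ x⊆w)) (𝔽.comb b (proj₁ ∘ y⊆w))
        (trans (combination x x⊆w a) (trans ax≈by (sym (combination y y⊆w b)))) k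
        where
        combination : ∀ {p} (x : Vec p) (x⊆w : ∀ j → InSpan w (x j)) (a : 𝔽.Vec p) →
                      lin (𝔽.comb a (proj₁ ∘ x⊆w)) w ≈ sum (λ i → ι (a i) * x i)
        combination x x⊆w a = trans (lin-comb a (proj₁ ∘ x⊆w) w) (sum-cong λ i → *-congˡ (proj₂ (x⊆w i)))

  -- Extension of scalars and the two equivalences.

  ι-comb : ∀ {m n} (x : 𝔽.Vec m) (v : FormsF.Matrix m n) i → ι (𝔽.comb x v i) ≈ comb (ι ∘ x) (ιᵐ v) i
  ι-comb x v i = trans (ι-sum λ j → x j 𝔽.* v j i) (sum-cong λ j → ι-* (x j) (v j i))

  ι-areInverse : ∀ {m n} {M : FormsF.Matrix m n} {N : FormsF.Matrix n m} →
                 SimF.AreInverse M N → SimL.AreInverse (ιᵐ M) (ιᵐ N)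
  ι-areInverse {M = M} {N} (MN , NM) = transfer N M MN , transfer M N NM
    where
    transfer : ∀ {m n} (M : FormsF.Matrix m n) (N : FormsF.Matrix n m) → (∀ k → 𝔽.comb (M k) N 𝔽.≋ 𝔽.δ k) →
               ∀ k → comb (ιᵐ M k) (ιᵐ N) ≋ δ k
    transfer M N NM k i = trans (sym (ι-comb (M k) N i)) (trans (ι-cong (NM k i)) (ι-δ k i))

  ι-Q : ∀ {n} (d x : 𝔽.Vec n) → ι (FormsF.Q d x) ≈ FormsL.Q (ι ∘ d) (ι ∘ x)
  ι-Q d x = trans (ι-sum λ i → d i 𝔽.* (x i 𝔽.* x i)) (sum-cong λ i → trans (ι-* (d i) _) (*-congˡ (ι-* (x i) (x i))))

  ι-B : ∀ {n} (g : FormsF.Matrix n n) (x y : 𝔽.Vec n) → ι (FormsF.B g x y) ≈ FormsL.B (ιᵐ g) (ι ∘ x) (ι ∘ y)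
  ι-B g x y = trans (ι-sum λ i → 𝔽.sum λ j → g i j 𝔽.* (x i 𝔽.* y j))
    (sum-cong λ i → trans (ι-sum λ j → g i j 𝔽.* (x i 𝔽.* y j))
      (sum-cong λ j → trans (ι-* (g i j) _) (*-congˡ (ι-* (x i) (y j)))))

  ι-alternating : ∀ {n} {a : FormsF.Matrix n n} → SimF.Alternating a → SimL.Alternating (ιᵐ a)
  ι-alternating a-alt i j i≢j = trans (sym (ι-+ _ _)) (trans (ι-cong (a-alt i j i≢j)) ι-0)

  ι-≉0 : ∀ {x} → ¬ x 𝔽.≈ 𝔽.0# → ¬ ι x ≈ 0#
  ι-≉0 x≉0 ιx≈0 = x≉0 (ι-injective ιx≈0)

  -- Upwards, the matrices of a similarity are mapped by `ι`. Downwards, a similarity over `L` gives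
  -- a weak one, which descends and is completed over `F`.
  quadratic⇔ : ∀ {m n} (φ : QuadraticForm F m) (ψ : QuadraticForm F n) →
    Quadratic.TotallySingular φ → Quadratic.TotallySingular ψ →
    Quadratic.Similar φ ψ ⇔ Quadratic.Similar (extendQ E φ) (extendQ E ψ)
  quadratic⇔ {m} {n} (quadraticForm a) (quadraticForm b) φ-ts ψ-ts = mk⇔ to from
    where
    a-alt : SimF.Alternating a
    a-alt = FormsF.totallySingular⇒polar≈0 {a = a} φ-ts

    b-alt : SimF.Alternating b
    b-alt = FormsF.totallySingular⇒polar≈0 {a = b} ψ-ts

    a-alt′ : SimL.Alternating (ιᵐ a)
    a-alt′ = ι-alternating {a = a} a-alt

    b-alt′ : SimL.Alternating (ιᵐ b)
    b-alt′ = ι-alternating {a = b} b-alt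

    to : FormsF.Quad.Similar (quadraticForm a) (quadraticForm b) →
         FormsL.Quad.Similar (quadraticForm (ιᵐ a)) (quadraticForm (ιᵐ b))
    to sim =
      let e , e≉0 , M , N , inv , eQM≈a = SimF.similarQ⇒matrix {a = a} {b} a-alt b-alt sim
      in SimL.matrix⇒similarQ {a = ιᵐ a} {ιᵐ b} a-alt′ b-alt′
        (ι e , ι-≉0 e≉0 , ιᵐ M , ιᵐ N , ι-areInverse {M = M} {N} inv , λ k →
         trans (*-congˡ (sym (ι-Q (SimF.diag b) (M k)))) (trans (sym (ι-* e _)) (ι-cong (eQM≈a k))))

    from : FormsL.Quad.Similar (quadraticForm (ιᵐ a)) (quadraticForm (ιᵐ b)) →
           FormsF.Quad.Similar (quadraticForm a) (quadraticForm b)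
    from sim =
      let e , e≉0 , M , N , inv , eQM≈a = SimL.similarQ⇒matrix {a = ιᵐ a} {ιᵐ b} a-alt′ b-alt′ sim
      in fromWeak (SimL.areInverse⇒≡ {M = M} {N} inv) b b-alt
           (λ k → e *ᵥ M k) N e≉0
           (SimL.similarity⇒weakQ {d = ι ∘ SimF.diag a} {ι ∘ SimF.diag b} {M} {N} inv eQM≈a)
      where
      -- `n` and `b` are generalised so that the equality `m ≡ n`, read off from the invertible
      -- matrix over `L`, can be matched.
      fromWeak : ∀ {n e} → m ≡ n → (b : FormsF.Matrix n n) → SimF.Alternating b →
                 (X : FormsL.Matrix m n) (Y : FormsL.Matrix n m) → ¬ e ≈ 0# →
                 SimL.WeakSimilarityQ (ι ∘ SimF.diag a) (ι ∘ SimF.diag b) e X Y →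
                 FormsF.Quad.Similar (quadraticForm a) (quadraticForm b)
      fromWeak ≡.refl b b-alt X Y e≉0 weak =
        let γ , γ≉0 , X′ , Y′ , quad , _ = descend X Y e≉0
        in SimF.weak⇒similarQ {a = a} {b} X′ Y′ a-alt b-alt γ≉0 (quad (SimF.diag a) (SimF.diag b) weak)

  -- Adjointness is carried along with the quadratic conditions, which by themselves see only the
  -- values `B g x x`.
  bilinear⇔ : ∀ {m n} (φ : BilinearForm F m) (ψ : BilinearForm F n) →
    Bilinear.Symmetric φ → Bilinear.Nonsingular φ → Bilinear.Symmetric ψ → Bilinear.Nonsingular ψ →
    Bilinear.Similar φ ψ ⇔ Bilinear.Similar (extendB E φ) (extendB E ψ)
  bilinear⇔ {m} {n} (bilinearForm g) (bilinearForm h) φ-sym φ-nonsing ψ-sym ψ-nonsing = mk⇔ to from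
    where
    g-sym : SimF.Symmetric g
    g-sym = FormsF.symmetricMatrix {g = g} φ-sym

    h-sym : SimF.Symmetric h
    h-sym = FormsF.symmetricMatrix {g = h} ψ-sym

    to : FormsF.Bil.Similar (bilinearForm g) (bilinearForm h) →
         FormsL.Bil.Similar (bilinearForm (ιᵐ g)) (bilinearForm (ιᵐ h))
    to sim =
      let e , e≉0 , M , N , inv , eBM≈g = SimF.similarB⇒matrix {g = g} {h} sim
      in SimL.matrix⇒similarB {g = ιᵐ g} {ιᵐ h}
        (ι e , ι-≉0 e≉0 , ιᵐ M , ιᵐ N , ι-areInverse {M = M} {N} inv , λ k l →
         trans (*-congˡ (sym (ι-B h (M k) (M l)))) (trans (sym (ι-* e _)) (ι-cong (eBM≈g k l))))

    from : FormsL.Bil.Similar (bilinearForm (ιᵐ g)) (bilinearForm (ιᵐ h)) →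
           FormsF.Bil.Similar (bilinearForm g) (bilinearForm h)
    from sim =
      let e , e≉0 , M , N , inv , eBM≈g = SimL.similarB⇒matrix {g = ιᵐ g} {ιᵐ h} sim
      in fromWeak (SimL.areInverse⇒≡ {M = M} {N} inv) h h-sym ψ-nonsing
           (λ k → e *ᵥ M k) N e≉0
           (SimL.similarity⇒weakQ {d = ι ∘ SimF.diag g} {ι ∘ SimF.diag h} {M} {N} inv
             (SimL.matrixSimilarB⇒Q {g = ιᵐ g} {ιᵐ h} {M} (λ i j → ι-cong (h-sym i j)) eBM≈g))
           (SimL.similarity⇒adjoint {g = ιᵐ g} {ιᵐ h} {M} {N} inv eBM≈g)
      where
      fromWeak : ∀ {n e} → m ≡ n → (h : FormsF.Matrix n n) → SimF.Symmetric h → FormsF.Bil.Nonsingular (bilinearForm h) →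
                 (X : FormsL.Matrix m n) (Y : FormsL.Matrix n m) → ¬ e ≈ 0# →
                 SimL.WeakSimilarityQ (ι ∘ SimF.diag g) (ι ∘ SimF.diag h) e X Y →
                 SimL.Adjoint (ιᵐ g) (ιᵐ h) X Y → FormsF.Bil.Similar (bilinearForm g) (bilinearForm h)
      fromWeak ≡.refl h h-sym h-nonsing X Y e≉0 weak adj =
        let γ , γ≉0 , X′ , Y′ , quad , adjoint = descend X Y e≉0
        in SimF.weak⇒similarB {g = g} {h} X′ Y′ g-sym h-sym φ-nonsing h-nonsing γ≉0
             (quad (SimF.diag g) (SimF.diag h) weak) (adjoint g h adj)

theorem5p2 : (∀ {ℓ} → ExcludedMiddle ℓ) →
    ∀ {c ℓ₁ ℓ₂ c′ ℓ₁′ ℓ₂′} (F : HeytingField c ℓ₁ ℓ₂) (L : HeytingField c′ ℓ₁′ ℓ₂′) (E : FieldExtension F L) →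
    HasCharacteristic2 F →
    IsSeparableAlgebraic E →
    (∀ {m n : ℕ} (φ : QuadraticForm F m) (ψ : QuadraticForm F n) →
    Quadratic.TotallySingular φ → Quadratic.TotallySingular ψ →
    Quadratic.Similar φ ψ ⇔ Quadratic.Similar (extendQ E φ) (extendQ E ψ))
    ×
    (∀ {m n : ℕ} (φ : BilinearForm F m) (ψ : BilinearForm F n) →
    Bilinear.Symmetric φ → Bilinear.Nonsingular φ →
    Bilinear.Symmetric ψ → Bilinear.Nonsingular ψ →
    Bilinear.Similar φ ψ ⇔ Bilinear.Similar (extendB E φ) (extendB E ψ))
theorem5p2 em F L E char2 separable = quadratic⇔ , bilinear⇔
  where open Descent em E char2 separable
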